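{- For every skew shape $\lambda/\mu$, the hybrid Grothendieck polynomial $G_{\lambda/\mu}(\mathbf{x};\mathbf{t};\mathbf{w})$ is symmetric in the variables $\mathbf{x}=(x_1,x_2,\ldots)$; that is, for every fixed monomial $\mathbf{t}^{\gamma}\mathbf{w}^{\theta}$, its coefficient (a formal power series in $\mathbf{x}$) is invariant under every permutation of the variables $x_1,x_2,\ldots$.
   Context: Partitions are identified with Young diagrams; boxes are written $(i,j)$ (row $i$, column $j$, matrix coordinates). For partitions $\mu\subseteq\lambda$, the skew shape $\lambda/\mu$ is the set of boxes of $\lambda$ not in $\mu$. For nonempty finite sets $A,B$ of positive integers write $A\le B$ if $\max A\le\min B$. A set-valued reverse plane partition (SVRPP) of shape $\lambda/\mu$ is a filling $T$ assigning to each box $(i,j)\in\lambda/\mu$ a nonempty finite set $T(i,j)$ of positive integers such that the sets weakly increase (in the order $\le$) from left to right along each row and from top to bottom down each column. Let $\mathrm{SVRPP}(\lambda/\mu)$ be the set of these. Statistics: $\mathrm{ircont}(T)=(r_1,r_2,\ldots)$, where $r_k$ is the number of columns of $T$ containing some box whose set contains $k$; $\mathrm{ceq}(T)=(c_1,c_2,\ldots)$, where $c_i$ is the number of boxes $(i,j)\in\lambda/\mu$ such that $(i+1,j)\in\lambda/\mu$ and $\max T(i,j)=\min T(i+1,j)$; $\mathrm{ex}(T)=(e_1,e_2,\ldots)$ with $e_i=\sum_{(i,j)\in\lambda/\mu}(|T(i,j)|-1)$. For a sequence of variables $\mathbf{y}$ and a weak composition $\alpha$, $\mathbf{y}^\alpha=\prod_k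 y_k^{\alpha_k}$. The hybrid Grothendieck polynomial is $$G_{\lambda/\mu}(\mathbf{x};\mathbf{t};\mathbf{w})=\sum_{T\in\mathrm{SVRPP}(\lambda/\mu)}\mathbf{x}^{\mathrm{ircont}(T)}\mathbf{t}^{\mathrm{ceq}(T)}\mathbf{w}^{\mathrm{ex}(T)},$$ with countably many variables $\mathbf{x}=(x_1,x_2,\ldots)$, $\mathbf{t}=(t_1,t_2,\ldots)$, $\mathbf{w}=(w_1,w_2,\ldots)$. -}

module Defs where

open import Data.Nat using (ℕ; zero; suc; _+_; _∸_; _≤_; _<_; _<ᵇ_; _≤ᵇ_; _≡ᵇ_; _⊔_; _⊓_)
open import Data.Bool using (Bool; true; false; _∧_; _∨_; if_then_else_)
open import Data.List using (List; []; _∷_; length; foldr)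
open import Data.Bool.ListAction using (any)
open import Data.Nat.ListAction using (sum)
open import Data.List.Relation.Unary.All using (All)
open import Data.List.Relation.Unary.Linked using (Linked)
open import Data.Product using (Σ; _×_; proj₁)
open import Relation.Binary.PropositionalEquality using (_≡_)

-- Partitions are lists of row lengths (row 1 first); trailing zeros allowed.
-- part p i = λ_i for i ≥ 1 (0 beyond the list), and part p 0 = 0.
part : List ℕ → ℕ → ℕ
part p zero = 0
part [] (suc i) = 0
part (x ∷ xs) (suc zero) = x
part (x ∷ xs) (suc (suc i)) = part xs (suc i)

IsPartition : List ℕ → Set
IsPartition p = ∀ i → part p (suc (suc i)) ≤ part p (suc i)

_⊆ₚ_ : List ℕ → List ℕ → Set
mu ⊆ₚ la = ∀ i → part mu i ≤ part la i

-- box (i , j) (1-indexed, matrix coordinates) lies in la / mu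
InSkew : List ℕ → List ℕ → ℕ → ℕ → Set
InSkew la mu i j = (part mu i < j) × (j ≤ part la i)

inB : List ℕ → List ℕ → ℕ → ℕ → Bool
inB la mu i j = (part mu i <ᵇ j) ∧ (j ≤ᵇ part la i)

-- Nonempty finite sets of positive integers, canonically represented
-- as nonempty strictly increasing lists of positive integers.
ValidSet : List ℕ → Set
ValidSet xs = (0 < length xs) × All (λ k → 1 ≤ k) xs × Linked _<_ xs

maxL : List ℕ → ℕ
maxL = foldr _⊔_ 0

minL : List ℕ → ℕ
minL [] = 0
minL (x ∷ xs) = foldr _⊓_ x xs

_≤S_ : List ℕ → List ℕ → Set
A ≤S B = maxL A ≤ minL B

memB : ℕ → List ℕ → Bool
memB k xs = any (λ y → k ≡ᵇ y) xs

-- A filling assigns a set to every box; only values on la/mu matter.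
Filling : Set
Filling = ℕ → ℕ → List ℕ

record IsSVRPP (la mu : List ℕ) (T : Filling) : Set where
  field
    valid : ∀ i j → InSkew la mu i j → ValidSet (T i j)
    rows  : ∀ i j j' → j < j' → InSkew la mu i j → InSkew la mu i j' → T i j ≤S T i j'
    cols  : ∀ i i' j → i < i' → InSkew la mu i j → InSkew la mu i' j → T i j ≤S T i' j

countTo : ℕ → (ℕ → Bool) → ℕ
countTo zero p = 0
countTo (suc n) p = countTo n p + (if p (suc n) then 1 else 0)

anyTo : ℕ → (ℕ → Bool) → Bool
anyTo zero p = false
anyTo (suc n) p = anyTo n p ∨ p (suc n)

sumTo : ℕ → (ℕ → ℕ) → ℕ
sumTo zero f = 0
sumTo (suc n) f = sumTo n f + f (suc n)

-- Statistics, as sequences indexed from 0: entry k refers to variable k+1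
-- (resp. row k+1).  Columns range over 1..sum la, rows over 1..length la,
-- which covers every box of la/mu.
ircont : List ℕ → List ℕ → Filling → ℕ → ℕ
ircont la mu T k =
  countTo (sum la) (λ j → anyTo (length la) (λ i → inB la mu i j ∧ memB (suc k) (T i j)))

ceq : List ℕ → List ℕ → Filling → ℕ → ℕ
ceq la mu T k =
  countTo (part la (suc k)) (λ j →
    inB la mu (suc k) j ∧ inB la mu (suc (suc k)) j
      ∧ (maxL (T (suc k) j) ≡ᵇ minL (T (suc (suc k)) j)))

ex : List ℕ → List ℕ → Filling → ℕ → ℕ
ex la mu T k =
  sumTo (part la (suc k)) (λ j → if inB la mu (suc k) j then length (T (suc k) j) ∸ 1 else 0)

-- The SVRPPs T of shape la/mu contributing to the monomial
-- x^α t^γ w^θ (exponent sequences shifted by one: α k = exponent of x_{k+1}).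
Coeff : List ℕ → List ℕ → (α γ θ : ℕ → ℕ) → Set
Coeff la mu α γ θ =
  Σ Filling (λ T → IsSVRPP la mu T
    × (∀ k → ircont la mu T k ≡ α k)
    × (∀ k → ceq la mu T k ≡ γ k)
    × (∀ k → ex la mu T k ≡ θ k))

SameOn : List ℕ → List ℕ → Filling → Filling → Set
SameOn la mu T T' = ∀ i j → InSkew la mu i j → T i j ≡ T' i j

-- Equal cardinality of two sets of SVRPPs of shape la/mu (the sets are
-- finite; equality of elements is SameOn): maps both ways, well defined
-- on SVRPPs and mutually inverse.
record SameSize (la mu : List ℕ) (A B : Set) (fa : A → Filling) (fb : B → Filling) : Set where
  field
    to      : A → B
    from    : B → A
    to-cong   : ∀ a a' → SameOn la mu (fa a) (fa a') → SameOn la mu (fb (to a)) (fb (to a'))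
    from-cong : ∀ b b' → SameOn la mu (fb b) (fb b') → SameOn la mu (fa (from b)) (fa (from b'))
    from-to : ∀ a → SameOn la mu (fa (from (to a))) (fa a)
    to-from : ∀ b → SameOn la mu (fb (to (from b))) (fb b)

CoeffEq : (la mu : List ℕ) (α γ θ α' γ' θ' : ℕ → ℕ) → Set
CoeffEq la mu α γ θ α' γ' θ' =
  SameSize la mu (Coeff la mu α γ θ) (Coeff la mu α' γ' θ') proj₁ proj₁

{-# OPTIONS --safe #-}

-- Permuting the variables reduces to exchanging x_a and x_b for b = a + 1.
-- Only the traces of the sets on {a , b} matter: they are nonempty on a convex
-- region, and each column of the region carries only a's, only b's, or a's
-- followed by b's, where the last row p containing a and the first row q
-- containing b satisfy q = p (one set contains both) or q = p + 1 (the only two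
-- adjacent boxes of the column whose sets do not meet).  Hence, up to
-- contributions not involving a and b, ceq and ex only count the columns with
-- given (p , q), and a Bender–Knuth involution in the style of Galashin,
-- Grinberg and Liu applies: turn all-a columns into all-b columns and vice
-- versa, then restore the order along the rows by letting neighbouring columns
-- trade their types (p , q).  This rewriting is confluent and terminating, and
-- the initial flip reverses its steps, so the composite is an involution.
module Submission where

open import Defs
open import Data.Bool using (Bool; true; false; if_then_else_; _∧_; _∨_) renaming (_≟_ to _≟ᵇ_)
open import Data.Bool.Properties using (T-≡; ⇔→≡; ∧-zeroʳ; ∧-identityʳ; ∨-identityʳ; ∧-distribˡ-∨; ¬-not)
open import Data.Empty using (⊥; ⊥-elim)
open import Data.List using (List; []; _∷_; _++_; length; filter)
open import Data.List.Membership.Propositional using (_∈_)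
open import Data.List.Membership.Propositional.Properties using (∈-filter⁺; ∈-filter⁻; ∈-++⁺ˡ; ∈-++⁺ʳ; ∈-++⁻; foldr-selective)
open import Data.List.Properties using (length-++)
open import Data.List.Relation.Unary.All as All using (All; []; _∷_)
open import Data.List.Relation.Unary.AllPairs using (AllPairs; []; _∷_)
import Data.List.Relation.Unary.AllPairs.Properties as AllPairs
open import Data.List.Relation.Unary.Any as Any using (here; there)
open import Data.List.Relation.Unary.Any.Properties using (any⁺; any⁻)
open import Data.List.Relation.Unary.Linked.Properties using (AllPairs⇒Linked; Linked⇒AllPairs)
open import Data.Nat
open import Data.Nat.Induction using (<-wellFounded)
open import Data.Nat.ListAction using (sum)
open import Data.Nat.Properties
open import Data.Nat.Tactic.RingSolver using (solve-∀)
open import Data.Product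
open import Data.Sum using (_⊎_; inj₁; inj₂; [_,_]′)
open import Data.Unit using (⊤; tt)
open import Data.Vec as Vec using (Vec; []; _∷_)
open import Data.Vec.Relation.Unary.All as VAll using ([]; _∷_)
open import Data.Vec.Relation.Unary.AllPairs as VPairs using ([]; _∷_)
open import Function using (_∘_; id; Equivalence; mk⇔)
open import Function.Bundles using (_↔_; Inverse)
open import Induction.WellFounded using (Acc; acc; module Subrelation)
open import Relation.Binary.Construct.Closure.ReflexiveTransitive as Star using (Star; ε; _◅_)
open import Relation.Binary.Construct.Closure.Transitive using (Plus; [_]; _∼⁺⟨_⟩_)
import Relation.Binary.Construct.On as On
open import Relation.Binary.PropositionalEquality hiding ([_])
open import Relation.Binary.Rewriting using (IsNormalForm; WeaklyConfluent; StronglyNormalizing; sn&wcr⇒cr)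
open import Relation.Nullary
open import Relation.Nullary.Decidable using (map′; _×-dec_; dec-true; dec-false)

-- The obstacle: a type `(p , q)` makes sense only in a column whose region reaches rows `p` and
-- `q`, so whether two letters may trade places depends on where they stand, and not every descent
-- is a redex. Convexity of the region ensures that every descent between neighbouring columns that
-- would violate the order along a row can be resolved. The exception is a pair of mixed columns,
-- which never trade. These cannot conflict: in an SVRPP the last `a` of the right one lies strictly
-- above the first `b` of the left one, and mixed columns never overtake each other. The rules
-- depend on the filling only through its region, which the involution preserves, so the way back
-- takes place in the same rewriting system.
--
-- An arbitrary `σ` may move infinitely many variables, and `α` is not assumed to have finite
-- support. A bound on the support is read off an SVRPP that contributes to the coefficient.
-- Different SVRPPs give different bounds, whereas the bijection needs one product of transpositions
-- for all of them; hence the detour through least bounds.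

toℕ : Bool → ℕ
toℕ c = if c then 1 else 0

-- Words and swaps of neighbouring letters

count : ∀ {A : Set} {n} → (A → Bool) → Vec A n → ℕ
count p []       = 0
count p (x ∷ xs) = count p xs + toℕ (p x)

-- The head of a vector is its rightmost letter, so that the letter heading a
-- vector of length n sits in column n.  Exchange n y x allows y in column 1 + n
-- and x in column 2 + n to trade places.
data Swap {A : Set} (Exchange : ℕ → A → A → Set) : ∀ {n} → Vec A n → Vec A n → Set where
  here  : ∀ {n x y} {w : Vec A n} → Exchange n y x → Swap Exchange (x ∷ y ∷ w) (y ∷ x ∷ w)
  there : ∀ {n x} {v w : Vec A n} → Swap Exchange v w → Swap Exchange (x ∷ v) (x ∷ w)

module _ {A : Set} {E F : ℕ → A → A → Set} where

  Swap-map : (∀ {n x y} → E n y x → F n y x) → ∀ {n} {v w : Vec A n} → Swap E v w → Swap F v w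
  Swap-map f (here e)  = here (f e)
  Swap-map f (there s) = there (Swap-map f s)

module _ {A : Set} {E : ℕ → A → A → Set} where

  count-Swap : ∀ (p : A → Bool) {n} {v w : Vec A n} → Star (Swap E) v w → count p v ≡ count p w
  count-Swap p ε        = refl
  count-Swap p (s ◅ ss) = trans (one-step s) (count-Swap p ss)
    where
    one-step : ∀ {n} {v w : Vec A n} → Swap E v w → count p v ≡ count p w
    one-step (here {x = x} {y} {w} _) = rearrange (count p w) (toℕ (p y)) (toℕ (p x))
      where
      rearrange : ∀ a b c → a + b + c ≡ a + c + b
      rearrange = solve-∀
    one-step (there s) = cong (_+ _) (one-step s)

  module _ {P : A → Set} where

    All-Swap : ∀ {n} {v w : Vec A n} → Swap E v w → VAll.All P v → VAll.All P w
    All-Swap (here _)  (px ∷ py ∷ pw) = py ∷ px ∷ pw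
    All-Swap (there s) (px ∷ pv)      = px ∷ All-Swap s pv

  AllPairs-Swap : {R : A → A → Set} → (∀ {n x y} → E n y x → R y x) →
    ∀ {n} {v w : Vec A n} → Star (Swap E) v w → VPairs.AllPairs R v → VPairs.AllPairs R w
  AllPairs-Swap {R} E⇒R ε        ps = ps
  AllPairs-Swap {R} E⇒R (s ◅ ss) ps = AllPairs-Swap E⇒R ss (one-step s ps)
    where
    one-step : ∀ {n} {v w : Vec A n} → Swap E v w → VPairs.AllPairs R v → VPairs.AllPairs R w
    one-step (here e)  ((_ ∷ xw) ∷ yw ∷ ps) = (E⇒R e ∷ yw) ∷ xw ∷ ps
    one-step (there s) (xv ∷ ps)            = All-Swap s xv ∷ one-step s ps

data Columns {A : Set} (P : ℕ → A → Set) : ∀ {n} → Vec A n → Set where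
  []  : Columns P []
  _∷_ : ∀ {n x} {w : Vec A n} → P (suc n) x → Columns P w → Columns P (x ∷ w)

Columns-Swap : ∀ {A : Set} {E : ℕ → A → A → Set} {P : ℕ → A → Set} →
  (∀ {n x y} → E n y x → P (1 + n) y → P (2 + n) x → P (1 + n) x × P (2 + n) y) →
  ∀ {n} {v w : Vec A n} → Star (Swap E) v w → Columns P v → Columns P w
Columns-Swap f ε        ps = ps
Columns-Swap {E = E} {P} f (s ◅ ss) ps = Columns-Swap f ss (one-step s ps)
  where
  one-step : ∀ {n} {v w : Vec _ n} → Swap E v w → Columns P v → Columns P w
  one-step (here e)  (px ∷ py ∷ ps) with f e py px
  ... | px′ , py′ = py′ ∷ px′ ∷ ps
  one-step (there s) (px ∷ ps) = px ∷ one-step s ps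

-- Sorting as a terminating and confluent rewriting system

module Sorting {A : Set} (Exchange : ℕ → A → A → Set)
  (exchange? : ∀ n y x → Dec (Exchange n y x))
  (rank : A → ℕ)
  (exchange-rank : ∀ {n y x} → Exchange n y x → rank x < rank y)
  (exchange-braid : ∀ {n z y x} → Exchange n z y → Exchange (suc n) y x →
    (Exchange n z x × Exchange (suc n) z x) × (Exchange (suc n) z y × Exchange n y x))
  where

  infix 4 _⟶_ _↠_

  _⟶_ : ∀ {n} → Vec A n → Vec A n → Set
  _⟶_ = Swap Exchange

  _↠_ : ∀ {n} → Vec A n → Vec A n → Set
  _↠_ = Star _⟶_

  Normal : ∀ {n} → Vec A n → Set
  Normal = IsNormalForm _⟶_

  private
    above : A → A → Bool
    above x y = does (rank x <? rank y)

    inversions : ∀ {n} → Vec A n → ℕ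
    inversions []      = 0
    inversions (x ∷ w) = count (above x) w + inversions w

    above-true : ∀ {x y} → rank x < rank y → toℕ (above x y) ≡ 1
    above-true {x} {y} lt = cong toℕ (dec-true (rank x <? rank y) lt)

    above-false : ∀ {x y} → rank x < rank y → toℕ (above y x) ≡ 0
    above-false {x} {y} lt = cong toℕ (dec-false (rank y <? rank x) (<-asym lt))

    -- A swap changes the relative order of one pair only, and `exchange-rank` says that this pair
    -- was inverted; hence exactly one inversion disappears.
    inversions-⟶ : ∀ {n} {v w : Vec A n} → v ⟶ w → inversions w < inversions v
    inversions-⟶ (here {x = x} {y} {w} e)
      rewrite above-true (exchange-rank e) | above-false (exchange-rank e)
      = ≤-reflexive (rearrange (count (above x) w) (count (above y) w) (inversions w))
      where
      rearrange : ∀ a b c → suc (b + 0 + (a + c)) ≡ a + 1 + (b + c)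
      rearrange = solve-∀
    inversions-⟶ (there {x = x} {v} {w} s) rewrite count-Swap (above x) (s ◅ ε) =
      +-monoʳ-< (count (above x) w) (inversions-⟶ s)

    sn : ∀ {n} → StronglyNormalizing (Plus (_⟶_ {n}))
    sn = Subrelation.wellFounded decreasing (On.wellFounded inversions <-wellFounded)
      where
      decreasing : ∀ {n} {w v : Vec A n} → Plus _⟶_ v w → inversions w < inversions v
      decreasing [ s ]           = inversions-⟶ s
      decreasing (_ ∼⁺⟨ s ⟩ t) = <-trans (decreasing t) (decreasing s)

    -- The only critical pair is `z y x` with both neighbouring pairs exchangeable. Either first
    -- move can be continued to `x y z`, and `exchange-braid` supplies the exchanges at the columns
    -- that the letters have reached by then.
    wcr : ∀ {n} → WeaklyConfluent (_⟶_ {n})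
    wcr (here e)  (here f)          = _ , ε , ε
    wcr (here e)  (there (here f)) with exchange-braid f e
    ... | (zx , zx′) , (zy , yx) = _ , there (here zx) ◅ here zy ◅ ε , here zx′ ◅ there (here yx) ◅ ε
    wcr (here e)  (there (there t)) = _ , there (there t) ◅ ε , here e ◅ ε
    wcr (there (here f)) (here e) with exchange-braid f e
    ... | (zx , zx′) , (zy , yx) = _ , here zx′ ◅ there (here yx) ◅ ε , there (here zx) ◅ here zy ◅ ε
    wcr (there (there s)) (here f)  = _ , here f ◅ ε , there (there s) ◅ ε
    wcr (there s) (there t) with wcr s t
    ... | d , ss , ts = _ ∷ d , Star.gmap (_ ∷_) there ss , Star.gmap (_ ∷_) there ts

    step? : ∀ {n} (w : Vec A n) → Dec (∃ (w ⟶_))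
    step? []       = no λ ()
    step? (x ∷ []) = no λ { (_ , there ()) }
    step? (x ∷ y ∷ w) with exchange? _ y x | step? (y ∷ w)
    ... | yes e | _           = yes (_ , here e)
    ... | no _  | yes (_ , s) = yes (_ , there s)
    ... | no ¬e | no ¬s       = no λ { (_ , here e) → ¬e e ; (_ , there s) → ¬s (_ , s) }

    normalise : ∀ {n} (w : Vec A n) → Acc _<_ (inversions w) → ∃ λ v → (w ↠ v) × Normal v
    normalise w (acc rs) with step? w
    ... | no nf       = w , ε , nf
    ... | yes (v , s) with normalise v (rs (inversions-⟶ s))
    ...   | u , ss , nf = u , s ◅ ss , nf

  abstract
    norm : ∀ {n} → Vec A n → Vec A n
    norm w = proj₁ (normalise w (<-wellFounded _))

    norm-↠ : ∀ {n} (w : Vec A n) → w ↠ norm w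
    norm-↠ w = proj₁ (proj₂ (normalise w (<-wellFounded _)))

    norm-normal : ∀ {n} (w : Vec A n) → Normal (norm w)
    norm-normal w = proj₂ (proj₂ (normalise w (<-wellFounded _)))

    -- Newman's lemma gives a common reduct of `norm w` and `v`; both are normal, so both paths to
    -- it are empty.
    norm-unique : ∀ {n} {w v : Vec A n} → w ↠ v → Normal v → norm w ≡ v
    norm-unique {w = w} {v} w↠v nf with sn&wcr⇒cr sn wcr (norm-↠ w) w↠v
    ... | _ , ε , ε           = refl
    ... | _ , ε , (s ◅ _)     = contradiction (_ , s) nf
    ... | _ , (s ◅ _) , _     = contradiction (_ , s) (norm-normal w)

-- Booleans, and finite sets as sorted lists

bool-ext : ∀ {b c : Bool} → (b ≡ true → c ≡ true) → (c ≡ true → b ≡ true) → b ≡ c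
bool-ext f g = ⇔→≡ (mk⇔ f g)

∧-trueˡ : ∀ {b c} → b ∧ c ≡ true → b ≡ true
∧-trueˡ {true} _ = refl

∧-trueʳ : ∀ {b c} → b ∧ c ≡ true → c ≡ true
∧-trueʳ {true} c = c

∨-true : ∀ {b c} → b ∨ c ≡ true → b ≡ true ⊎ c ≡ true
∨-true {true}  _ = inj₁ refl
∨-true {false} c = inj₂ c

∨-trueʳ : ∀ b {c} → c ≡ true → b ∨ c ≡ true
∨-trueʳ true  _ = refl
∨-trueʳ false c = c

not-both-true : ∀ {b c} → b ≡ false ⊎ c ≡ false → b ≡ true → c ≡ true → ⊥
not-both-true (inj₁ refl) ()
not-both-true (inj₂ refl) _ ()

≡ᵇ-true : ∀ {m n} → (m ≡ᵇ n) ≡ true → m ≡ n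
≡ᵇ-true {m} {n} = ≡ᵇ⇒≡ m n ∘ Equivalence.from T-≡

true-≡ᵇ : ∀ {m n} → m ≡ n → (m ≡ᵇ n) ≡ true
true-≡ᵇ {m} {n} = Equivalence.to T-≡ ∘ ≡⇒≡ᵇ m n

≤ᵇ-true : ∀ {m n} → (m ≤ᵇ n) ≡ true → m ≤ n
≤ᵇ-true {m} {n} = ≤ᵇ⇒≤ m n ∘ Equivalence.from T-≡

true-≤ᵇ : ∀ {m n} → m ≤ n → (m ≤ᵇ n) ≡ true
true-≤ᵇ = Equivalence.to T-≡ ∘ ≤⇒≤ᵇ

memB⇒∈ : ∀ {c xs} → memB c xs ≡ true → c ∈ xs
memB⇒∈ {c} {xs} = Any.map (≡ᵇ⇒≡ c _) ∘ any⁻ (c ≡ᵇ_) xs ∘ Equivalence.from T-≡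

∈⇒memB : ∀ {c xs} → c ∈ xs → memB c xs ≡ true
∈⇒memB {c} = Equivalence.to T-≡ ∘ any⁺ (c ≡ᵇ_) ∘ Any.map (≡⇒≡ᵇ c _)

∈⇒≤maxL : ∀ {x xs} → x ∈ xs → x ≤ maxL xs
∈⇒≤maxL {xs = y ∷ xs} (here refl) = m≤m⊔n y (maxL xs)
∈⇒≤maxL {xs = y ∷ xs} (there x∈)  = ≤-trans (∈⇒≤maxL x∈) (m≤n⊔m y (maxL xs))

minL≤head : ∀ x xs → minL (x ∷ xs) ≤ x
minL≤head x []       = ≤-refl
minL≤head x (y ∷ xs) = ≤-trans (m⊓n≤n y _) (minL≤head x xs)

-- The head is the seed of the fold, so the recursion drops the second element and keeps the first.
minL≤∈ : ∀ {x xs} → x ∈ xs → minL xs ≤ x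
minL≤∈ {xs = y ∷ xs} (here refl) = minL≤head y xs
minL≤∈ {xs = y ∷ z ∷ xs} (there (here refl)) = m⊓n≤m z _
minL≤∈ {xs = y ∷ z ∷ xs} (there (there x∈))  = ≤-trans (m⊓n≤n z _) (minL≤∈ {xs = y ∷ xs} (there x∈))

maxL∈ : ∀ {x xs} → x ∈ xs → maxL xs ∈ xs
maxL∈ {x} {xs} x∈ with foldr-selective ⊔-sel 0 xs
... | inj₂ max∈ = max∈
-- The seed `0` need not be an element, but a maximum of `0` forces the given element to be `0`.
... | inj₁ max≡0 with n≤0⇒n≡0 (subst (x ≤_) max≡0 (∈⇒≤maxL x∈))
...   | refl = subst (_∈ xs) (sym max≡0) x∈

minL∈ : ∀ {x xs} → x ∈ xs → minL xs ∈ xs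
minL∈ {xs = y ∷ xs} _ with foldr-selective ⊓-sel y xs
... | inj₁ min≡y = here min≡y
... | inj₂ min∈  = there min∈

≤S⇒≤ : ∀ {xs ys x y} → xs ≤S ys → x ∈ xs → y ∈ ys → x ≤ y
≤S⇒≤ xs≤ys x∈ y∈ = ≤-trans (∈⇒≤maxL x∈) (≤-trans xs≤ys (minL≤∈ y∈))

≤⇒≤S : ∀ {xs ys u v} → u ∈ xs → v ∈ ys → (∀ {x y} → x ∈ xs → y ∈ ys → x ≤ y) → xs ≤S ys
≤⇒≤S u∈ v∈ le = le (maxL∈ u∈) (minL∈ v∈)

-- For sets in the order `≤S`, maximum and minimum coincide exactly when the sets share an element.
-- Thus `ceq` counts intersecting vertical neighbours, and only membership has to be tracked.
Meet : List ℕ → List ℕ → Set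
Meet xs ys = ∃ λ c → c ∈ xs × c ∈ ys

max≡min⇒Meet : ∀ {xs ys u v} → u ∈ xs → v ∈ ys → (maxL xs ≡ᵇ minL ys) ≡ true → Meet xs ys
max≡min⇒Meet {xs} {ys} u∈ v∈ eq = maxL xs , maxL∈ u∈ , subst (_∈ ys) (sym (≡ᵇ-true eq)) (minL∈ v∈)

Meet⇒max≡min : ∀ {xs ys} → xs ≤S ys → Meet xs ys → (maxL xs ≡ᵇ minL ys) ≡ true
Meet⇒max≡min xs≤ys (c , c∈xs , c∈ys) =
  true-≡ᵇ (≤-antisym xs≤ys (≤-trans (minL≤∈ c∈ys) (∈⇒≤maxL c∈xs)))

Sorted : List ℕ → Set
Sorted = AllPairs _<_

ValidSet⇒Sorted : ∀ {xs} → ValidSet xs → Sorted xs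
ValidSet⇒Sorted (_ , _ , lk) = Linked⇒AllPairs <-trans lk

ValidSet⇒∈ : ∀ {xs} → ValidSet xs → ∃ (_∈ xs)
ValidSet⇒∈ {x ∷ xs} _ = x , here refl

Sorted-ext : ∀ {xs ys} → Sorted xs → Sorted ys →
  (∀ {c} → c ∈ xs → c ∈ ys) → (∀ {c} → c ∈ ys → c ∈ xs) → xs ≡ ys
Sorted-ext {[]}     {[]}     _ _ _ _ = refl
Sorted-ext {[]}     {y ∷ ys} _ _ _ g with () ← g (here refl)
Sorted-ext {x ∷ xs} {[]}     _ _ f _ with () ← f (here refl)
Sorted-ext {x ∷ xs} {y ∷ ys} (x< ∷ sx) (y< ∷ sy) f g with x≡y
  where
  x≡y : x ≡ y
  x≡y with f (here refl) | g (here refl)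
  ... | here eq   | _         = eq
  ... | there _   | here eq   = sym eq
  ... | there x∈  | there y∈  = contradiction (All.lookup x< y∈) (<-asym (All.lookup y< x∈))
... | refl = cong (x ∷_) (Sorted-ext sx sy f′ g′)
  where
  f′ : ∀ {c} → c ∈ xs → c ∈ ys
  f′ c∈ with f (there c∈)
  ... | there c∈′ = c∈′
  ... | here refl = contradiction (All.lookup x< c∈) (<-irrefl refl)
  g′ : ∀ {c} → c ∈ ys → c ∈ xs
  g′ c∈ with g (there c∈)
  ... | there c∈′ = c∈′
  ... | here refl = contradiction (All.lookup y< c∈) (<-irrefl refl)

onlyIf : Bool → ℕ → List ℕ
onlyIf true  c = c ∷ []
onlyIf false c = []

∈-onlyIf⁻ : ∀ {c d} s → c ∈ onlyIf s d → c ≡ d × s ≡ true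
∈-onlyIf⁻ true (here eq) = eq , refl

∈-onlyIf⁺ : ∀ {s} c → s ≡ true → c ∈ onlyIf s c
∈-onlyIf⁺ c refl = here refl

-- Changing the trace of a set on two consecutive values

module Replace (a : ℕ) where

  b : ℕ
  b = suc a

  lower upper : List ℕ → List ℕ
  lower = filter (_<? a)
  upper = filter (b <?_)

  replace : Bool → Bool → List ℕ → List ℕ
  replace s t xs = lower xs ++ onlyIf s a ++ onlyIf t b ++ upper xs

  data ∈Replace (s t : Bool) (xs : List ℕ) (c : ℕ) : Set where
    isA   : c ≡ a → s ≡ true → ∈Replace s t xs c
    isB   : c ≡ b → t ≡ true → ∈Replace s t xs c
    other : c ≢ a → c ≢ b → c ∈ xs → ∈Replace s t xs c

  module _ {s t : Bool} {xs : List ℕ} where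

    ∈-replace⁻ : ∀ {c} → c ∈ replace s t xs → ∈Replace s t xs c
    ∈-replace⁻ c∈ with ∈-++⁻ (lower xs) c∈
    ... | inj₁ c∈l = let c∈xs , c<a = ∈-filter⁻ (_<? a) {xs = xs} c∈l in
      other (<⇒≢ c<a) (<⇒≢ (m<n⇒m<1+n c<a)) c∈xs
    ... | inj₂ c∈′ with ∈-++⁻ (onlyIf s a) c∈′
    ...   | inj₁ c∈a = let eq , s-true = ∈-onlyIf⁻ s c∈a in isA eq s-true
    ...   | inj₂ c∈″ with ∈-++⁻ (onlyIf t b) c∈″
    ...     | inj₁ c∈b = let eq , t-true = ∈-onlyIf⁻ t c∈b in isB eq t-true
    ...     | inj₂ c∈u = let c∈xs , b<c = ∈-filter⁻ (b <?_) {xs = xs} c∈u in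
      other (≢-sym (<⇒≢ (<-trans (n<1+n a) b<c))) (≢-sym (<⇒≢ b<c)) c∈xs

    ∈-replace⁺ : ∀ {c} → ∈Replace s t xs c → c ∈ replace s t xs
    ∈-replace⁺ (isA refl s-true) = ∈-++⁺ʳ (lower xs) (∈-++⁺ˡ (∈-onlyIf⁺ a s-true))
    ∈-replace⁺ (isB refl t-true) = ∈-++⁺ʳ (lower xs) (∈-++⁺ʳ (onlyIf s a) (∈-++⁺ˡ (∈-onlyIf⁺ b t-true)))
    ∈-replace⁺ {c} (other c≢a c≢b c∈) with c <? a
    ... | yes c<a = ∈-++⁺ˡ (∈-filter⁺ (_<? a) c∈ c<a)
    ... | no  c≮a = ∈-++⁺ʳ (lower xs) (∈-++⁺ʳ (onlyIf s a) (∈-++⁺ʳ (onlyIf t b)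
      (∈-filter⁺ (b <?_) c∈ (≤∧≢⇒< (≤∧≢⇒< (≮⇒≥ c≮a) (≢-sym c≢a)) (≢-sym c≢b)))))

    replace-Sorted : Sorted xs → Sorted (replace s t xs)
    replace-Sorted sorted =
      AllPairs.++⁺ (AllPairs.filter⁺ (_<? a) sorted)
        (AllPairs.++⁺ (onlyIf-Sorted s)
          (AllPairs.++⁺ (onlyIf-Sorted t) (AllPairs.filter⁺ (b <?_) sorted)
            (All.tabulate λ x∈ → All.tabulate (b<upper x∈)))
          (All.tabulate λ x∈ → All.tabulate (a<rest x∈)))
        (All.tabulate λ x∈ → All.tabulate (lower<rest x∈))
      where
      onlyIf-Sorted : ∀ s {c} → Sorted (onlyIf s c)
      onlyIf-Sorted true  = [] ∷ []
      onlyIf-Sorted false = []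
      b<upper : ∀ {x y} → x ∈ onlyIf t b → y ∈ upper xs → x < y
      b<upper x∈ y∈ with ∈-onlyIf⁻ t x∈ | ∈-filter⁻ (b <?_) {xs = xs} y∈
      ... | refl , _ | _ , b<y = b<y
      b≤rest : ∀ {y} → y ∈ onlyIf t b ++ upper xs → b ≤ y
      b≤rest y∈ with ∈-++⁻ (onlyIf t b) y∈
      ... | inj₁ y∈b = ≤-reflexive (sym (proj₁ (∈-onlyIf⁻ t y∈b)))
      ... | inj₂ y∈u = <⇒≤ (proj₂ (∈-filter⁻ (b <?_) {xs = xs} y∈u))
      a<rest : ∀ {x y} → x ∈ onlyIf s a → y ∈ onlyIf t b ++ upper xs → x < y
      a<rest x∈ y∈ with ∈-onlyIf⁻ s x∈
      ... | refl , _ = b≤rest y∈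
      lower<rest : ∀ {x y} → x ∈ lower xs → y ∈ onlyIf s a ++ onlyIf t b ++ upper xs → x < y
      lower<rest x∈ y∈ with ∈-filter⁻ (_<? a) {xs = xs} x∈ | ∈-++⁻ (onlyIf s a) y∈
      ... | _ , x<a | inj₁ y∈a = subst (_ <_) (sym (proj₁ (∈-onlyIf⁻ s y∈a))) x<a
      ... | _ , x<a | inj₂ y∈r = <-trans x<a (b≤rest y∈r)

    replace-Valid : 1 ≤ a → s ∨ t ≡ true → ValidSet xs → ValidSet (replace s t xs)
    replace-Valid 1≤a s∨t valid@(_ , positive , _) =
      nonempty (proj₂ witness) , All.tabulate (1≤∈ ∘ ∈-replace⁻) , AllPairs⇒Linked (replace-Sorted (ValidSet⇒Sorted valid))
      where
      nonempty : ∀ {c ys} → c ∈ ys → 0 < length ys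
      nonempty {ys = _ ∷ _} _ = z<s
      witness : ∃ (_∈ replace s t xs)
      witness with ∨-true {s} s∨t
      ... | inj₁ s-true = a , ∈-replace⁺ (isA refl s-true)
      ... | inj₂ t-true = b , ∈-replace⁺ (isB refl t-true)
      1≤∈ : ∀ {c} → ∈Replace s t xs c → 1 ≤ c
      1≤∈ (isA refl _)    = 1≤a
      1≤∈ (isB refl _)    = s≤s z≤n
      1≤∈ (other _ _ c∈) = All.lookup positive c∈

  replace-self : ∀ {xs} → Sorted xs → replace (memB a xs) (memB b xs) xs ≡ xs
  replace-self {xs} sorted = Sorted-ext (replace-Sorted {memB a xs} {memB b xs} sorted) sorted (f ∘ ∈-replace⁻) (∈-replace⁺ ∘ g)
    where
    f : ∀ {c} → ∈Replace (memB a xs) (memB b xs) xs c → c ∈ xs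
    f (isA refl a∈)  = memB⇒∈ a∈
    f (isB refl b∈)  = memB⇒∈ b∈
    f (other _ _ c∈) = c∈
    g : ∀ {c} → c ∈ xs → ∈Replace (memB a xs) (memB b xs) xs c
    g {c} c∈ with c ≟ a | c ≟ b
    ... | yes refl | _        = isA refl (∈⇒memB c∈)
    ... | no _     | yes refl = isB refl (∈⇒memB c∈)
    ... | no c≢a   | no c≢b   = other c≢a c≢b c∈

  length-replace : ∀ s t xs →
    length (replace s t xs) ≡ length (lower xs) + length (upper xs) + (toℕ s + toℕ t)
  length-replace s t xs = begin
    length (replace s t xs)
      ≡⟨ length-++ (lower xs) ⟩
    length (lower xs) + length (onlyIf s a ++ onlyIf t b ++ upper xs)
      ≡⟨ cong (length (lower xs) +_) (length-++ (onlyIf s a)) ⟩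
    length (lower xs) + (length (onlyIf s a) + length (onlyIf t b ++ upper xs))
      ≡⟨ cong (λ n → length (lower xs) + (length (onlyIf s a) + n)) (length-++ (onlyIf t b)) ⟩
    length (lower xs) + (length (onlyIf s a) + (length (onlyIf t b) + length (upper xs)))
      ≡⟨ cong₂ (λ m n → length (lower xs) + (m + (n + length (upper xs)))) (length-onlyIf s) (length-onlyIf t) ⟩
    length (lower xs) + (toℕ s + (toℕ t + length (upper xs)))
      ≡⟨ rearrange (length (lower xs)) (toℕ s) (toℕ t) (length (upper xs)) ⟩
    length (lower xs) + length (upper xs) + (toℕ s + toℕ t) ∎
    where
    open ≡-Reasoning
    length-onlyIf : ∀ s {c} → length (onlyIf s c) ≡ toℕ s
    length-onlyIf true  = refl
    length-onlyIf false = refl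
    rearrange : ∀ l m n u → l + (m + (n + u)) ≡ l + u + (m + n)
    rearrange = solve-∀

  -- The old and the new set each contain `a` or `b`, so their sizes differ only by whether both
  -- occur. The additive form avoids differences, and both sets being nonempty keeps `∸ 1` from
  -- truncating.
  excess-replace : ∀ {s t xs} → Sorted xs → s ∨ t ≡ true → memB a xs ∨ memB b xs ≡ true →
    (length xs ∸ 1) + toℕ (s ∧ t) ≡ (length (replace s t xs) ∸ 1) + toℕ (memB a xs ∧ memB b xs)
  excess-replace {s} {t} {xs} sorted s∨t m∨m
    rewrite length-replace s t xs
    = trans (cong (λ n → (n ∸ 1) + toℕ (s ∧ t)) length-xs)
        (combine s t (memB a xs) (memB b xs) (length (lower xs) + length (upper xs)) s∨t m∨m)
    where
    length-xs : length xs ≡ length (lower xs) + length (upper xs) + (toℕ (memB a xs) + toℕ (memB b xs))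
    length-xs = trans (cong length (sym (replace-self sorted))) (length-replace (memB a xs) (memB b xs) xs)
    one-more : ∀ n → n + 1 ∸ 1 + 1 ≡ n + 2 ∸ 1 + 0
    one-more n rewrite +-comm n 1 | +-comm n 2 = trans (+-comm n 1) (sym (+-identityʳ _))
    combine : ∀ s t u v n → s ∨ t ≡ true → u ∨ v ≡ true →
      (n + (toℕ u + toℕ v) ∸ 1) + toℕ (s ∧ t) ≡ (n + (toℕ s + toℕ t) ∸ 1) + toℕ (u ∧ v)
    combine true  true  true  true  n _ _ = refl
    combine true  true  true  false n _ _ = one-more n
    combine true  true  false true  n _ _ = one-more n
    combine true  false true  true  n _ _ = sym (one-more n)
    combine false true  true  true  n _ _ = sym (one-more n)
    combine true  false true  false n _ _ = refl
    combine true  false false true  n _ _ = refl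
    combine false true  true  false n _ _ = refl
    combine false true  false true  n _ _ = refl

-- Searching, counting and summing over an initial segment

InRange : ℕ → ℕ → Set
InRange n i = 1 ≤ i × i ≤ n

InRange-suc : ∀ {n i} → InRange n i → InRange (suc n) i
InRange-suc (1≤i , i≤n) = 1≤i , m≤n⇒m≤1+n i≤n

InRange-last : ∀ {n} → InRange (suc n) (suc n)
InRange-last = s≤s z≤n , ≤-refl

InRange-case : ∀ {n i} → InRange (suc n) i → InRange n i ⊎ i ≡ suc n
InRange-case (1≤i , i≤1+n) with m≤n⇒m<n∨m≡n i≤1+n
... | inj₁ (s≤s i≤n) = inj₁ (1≤i , i≤n)
... | inj₂ eq        = inj₂ eq

anyTo⁻ : ∀ n {p} → anyTo n p ≡ true → ∃ λ i → InRange n i × p i ≡ true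
anyTo⁻ (suc n) eq with ∨-true eq
... | inj₂ pn = suc n , InRange-last , pn
... | inj₁ any with anyTo⁻ n any
...   | i , i∈ , pi = i , InRange-suc i∈ , pi

anyTo⁺ : ∀ {n i p} → InRange n i → p i ≡ true → anyTo n p ≡ true
anyTo⁺ {zero}  (s≤s _ , ())
anyTo⁺ {suc n} {p = p} i∈ pi with InRange-case i∈
... | inj₁ i∈n rewrite anyTo⁺ {n} {p = p} i∈n pi = refl
... | inj₂ refl = ∨-trueʳ (anyTo n p) pi

anyTo-cong : ∀ n {p q} → (∀ i → p i ≡ q i) → anyTo n p ≡ anyTo n q
anyTo-cong zero    p≗q = refl
anyTo-cong (suc n) p≗q = cong₂ _∨_ (anyTo-cong n p≗q) (p≗q (suc n))

-- Both are meaningful only when p holds somewhere in 1 … n.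
lastTo firstTo : ℕ → (ℕ → Bool) → ℕ
lastTo zero    p = 0
lastTo (suc n) p = if p (suc n) then suc n else lastTo n p
firstTo zero    p = 0
firstTo (suc n) p = if anyTo n p then firstTo n p else suc n

lastTo-cong : ∀ n {p q} → (∀ i → p i ≡ q i) → lastTo n p ≡ lastTo n q
lastTo-cong zero    p≗q = refl
lastTo-cong (suc n) p≗q rewrite p≗q (suc n) | lastTo-cong n p≗q = refl

firstTo-cong : ∀ n {p q} → (∀ i → p i ≡ q i) → firstTo n p ≡ firstTo n q
firstTo-cong zero    p≗q = refl
firstTo-cong (suc n) p≗q rewrite anyTo-cong n p≗q | firstTo-cong n p≗q = refl

lastTo-spec : ∀ n {i p} → InRange n i → p i ≡ true → i ≤ lastTo n p × p (lastTo n p) ≡ true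
lastTo-spec zero (s≤s _ , ())
lastTo-spec (suc n) {p = p} i∈ pi with p (suc n) in eq | InRange-case i∈
... | true  | _         = proj₂ i∈ , eq
... | false | inj₁ i∈n  = lastTo-spec n i∈n pi
... | false | inj₂ refl with () ← trans (sym eq) pi

firstTo-spec : ∀ n {i p} → InRange n i → p i ≡ true → firstTo n p ≤ i × p (firstTo n p) ≡ true
firstTo-spec zero (s≤s _ , ())
firstTo-spec (suc n) {p = p} i∈ pi with anyTo n p in eq | InRange-case i∈
... | true  | inj₁ i∈n = firstTo-spec n i∈n pi
... | true  | inj₂ refl with anyTo⁻ n eq
...   | i , i∈n , pi′ = let le , pf = firstTo-spec n i∈n pi′ in
  ≤-trans le (proj₂ (InRange-suc i∈n)) , pf
firstTo-spec (suc n) {p = p} i∈ pi | false | inj₁ i∈n with () ← trans (sym eq) (anyTo⁺ {p = p} i∈n pi)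
firstTo-spec (suc n) {p = p} i∈ pi | false | inj₂ refl = ≤-refl , pi

countTo≡sumTo : ∀ n {p} → countTo n p ≡ sumTo n (toℕ ∘ p)
countTo≡sumTo zero    = refl
countTo≡sumTo (suc n) {p} = cong (_+ toℕ (p (suc n))) (countTo≡sumTo n)

countTo-cong : ∀ n {p q} → (∀ j → InRange n j → p j ≡ q j) → countTo n p ≡ countTo n q
countTo-cong zero    p≗q = refl
countTo-cong (suc n) p≗q =
  cong₂ (λ m c → m + toℕ c) (countTo-cong n (λ j → p≗q j ∘ InRange-suc)) (p≗q (suc n) InRange-last)

sumTo-extend : ∀ {n f} d → (∀ j → n < j → f j ≡ 0) → sumTo (d + n) f ≡ sumTo n f
sumTo-extend zero    f≡0 = refl
sumTo-extend {n} (suc d) f≡0 rewrite f≡0 (suc (d + n)) (s≤s (m≤n+m n d)) =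
  trans (+-identityʳ _) (sumTo-extend d f≡0)

sumTo-≤ : ∀ {n m f} → n ≤ m → (∀ j → n < j → f j ≡ 0) → sumTo n f ≡ sumTo m f
sumTo-≤ {n} {m} {f} n≤m f≡0 =
  trans (sym (sumTo-extend (m ∸ n) f≡0)) (cong (λ k → sumTo k f) (m∸n+n≡m n≤m))

≤sumTo : ∀ n {j f} → InRange n j → f j ≤ sumTo n f
≤sumTo zero (s≤s _ , ())
≤sumTo (suc n) {f = f} j∈ with InRange-case j∈
... | inj₁ j∈n  = ≤-trans (≤sumTo n j∈n) (m≤m+n _ _)
... | inj₂ refl = m≤n+m _ (sumTo n f)

-- `ex` and `ceq` are not preserved column by column. The local defects are indicators of mixed
-- letters, whose totals agree, so they cancel in the sum over a row.
sumTo-balance : ∀ n {f g p q} → (∀ j → InRange n j → f j + toℕ (p j) ≡ g j + toℕ (q j)) →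
  countTo n p ≡ countTo n q → sumTo n f ≡ sumTo n g
sumTo-balance n {f} {g} {p} {q} balanced p≡q = +-cancelʳ-≡ (countTo n q) (sumTo n f) (sumTo n g)
  (subst (λ c → sumTo n f + c ≡ sumTo n g + countTo n q) p≡q (total n balanced))
  where
  interchange : ∀ a b c d → a + b + (c + d) ≡ a + c + (b + d)
  interchange = solve-∀
  total : ∀ n → (∀ j → InRange n j → f j + toℕ (p j) ≡ g j + toℕ (q j)) →
    sumTo n f + countTo n p ≡ sumTo n g + countTo n q
  total zero    _  = refl
  total (suc n) eq = begin
    sumTo n f + f (suc n) + (countTo n p + toℕ (p (suc n)))
      ≡⟨ interchange (sumTo n f) _ _ _ ⟩
    sumTo n f + countTo n p + (f (suc n) + toℕ (p (suc n)))
      ≡⟨ cong₂ _+_ (total n (λ j → eq j ∘ InRange-suc)) (eq (suc n) InRange-last) ⟩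
    sumTo n g + countTo n q + (g (suc n) + toℕ (q (suc n)))
      ≡⟨ interchange (sumTo n g) _ _ _ ⟨
    sumTo n g + g (suc n) + (countTo n q + toℕ (q (suc n))) ∎
    where open ≡-Reasoning

-- Words indexed by columns

module Words {A : Set} (default : A) where

  word : ∀ n → (ℕ → A) → Vec A n
  word zero    f = []
  word (suc n) f = f (suc n) ∷ word n f

  -- For letters the default will be `none`, the right value for columns outside the shape.
  at : ∀ {n} → Vec A n → ℕ → A
  at []              j = default
  at (_∷_ {n} x w) j = if does (j ≟ suc n) then x else at w j

  at-head : ∀ {n x} (w : Vec A n) → at (x ∷ w) (suc n) ≡ x
  at-head {n} {x} w = cong (λ c → if c then x else at w (suc n)) (dec-true (suc n ≟ suc n) refl)

  at-tail : ∀ {n x j} (w : Vec A n) → j ≢ suc n → at (x ∷ w) j ≡ at w j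
  at-tail {n} {x} {j} w j≢ = cong (λ c → if c then x else at w j) (dec-false (j ≟ suc n) j≢)

  at-tail′ : ∀ {n x j} (w : Vec A n) → InRange n j → at (x ∷ w) j ≡ at w j
  at-tail′ w (_ , j≤n) = at-tail w (<⇒≢ (s≤s j≤n))

  at-outside : ∀ {n j} (w : Vec A n) → ¬ InRange n j → at w j ≡ default
  at-outside []      j∉ = refl
  at-outside (x ∷ w) j∉ = trans (at-tail w λ { refl → j∉ InRange-last }) (at-outside w (j∉ ∘ InRange-suc))

  at-word : ∀ {n j f} → InRange n j → at (word n f) j ≡ f j
  at-word {zero}  (s≤s _ , ())
  at-word {suc n} {f = f} j∈ with InRange-case j∈
  ... | inj₁ j∈n  = trans (at-tail′ (word n f) j∈n) (at-word j∈n)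
  ... | inj₂ refl = at-head (word n f)

  word-unique : ∀ {n f} (w : Vec A n) → (∀ j → InRange n j → f j ≡ at w j) → word n f ≡ w
  word-unique []      f≗w = refl
  word-unique (x ∷ w) f≗w = cong₂ _∷_ (trans (f≗w _ InRange-last) (at-head w))
    (word-unique w λ j j∈ → trans (f≗w j (InRange-suc j∈)) (at-tail′ w j∈))

  word-cong : ∀ n {f g} → (∀ j → f j ≡ g j) → word n f ≡ word n g
  word-cong zero    f≗g = refl
  word-cong (suc n) f≗g = cong₂ _∷_ (f≗g (suc n)) (word-cong n f≗g)

  count≡countTo : ∀ (p : A → Bool) {n} (w : Vec A n) → count p w ≡ countTo n (p ∘ at w)
  count≡countTo p []      = refl
  count≡countTo p {suc n} (x ∷ w) = cong₂ (λ m c → m + toℕ c)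
    (trans (count≡countTo p w) (countTo-cong n λ j j∈ → sym (cong p (at-tail′ w j∈))))
    (sym (cong p (at-head w)))

  Columns-word : ∀ {P : ℕ → A → Set} n {f} → (∀ j → P j (f j)) → Columns P (word n f)
  Columns-word zero    Pf = []
  Columns-word (suc n) Pf = Pf (suc n) ∷ Columns-word n Pf

  Columns-at : ∀ {P : ℕ → A → Set} {n j} {w : Vec A n} → Columns P w → InRange n j → P j (at w j)
  Columns-at [] (s≤s _ , ())
  Columns-at {P} {j = j} {_ ∷ w} (px ∷ ps) j∈ with InRange-case j∈
  ... | inj₁ j∈n  = subst (P j) (sym (at-tail′ w j∈n)) (Columns-at ps j∈n)
  ... | inj₂ refl = subst (P j) (sym (at-head w)) px

  AllPairs-word : ∀ {R : A → A → Set} n {f} → (∀ {j j′} → j < j′ → R (f j′) (f j)) → VPairs.AllPairs R (word n f)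
  AllPairs-word zero    Rf = []
  AllPairs-word {R} (suc n) {f} Rf = all n ≤-refl ∷ AllPairs-word n Rf
    where
    all : ∀ m → m ≤ n → VAll.All (R (f (suc n))) (word m f)
    all zero    _   = []
    all (suc m) m<n = Rf (s≤s m<n) ∷ all m (<⇒≤ m<n)

  All-at : ∀ {P : A → Set} {n j} {w : Vec A n} → VAll.All P w → InRange n j → P (at w j)
  All-at [] (s≤s _ , ())
  All-at {P} {w = _ ∷ w} (px ∷ ps) j∈ with InRange-case j∈
  ... | inj₁ j∈n  = subst P (sym (at-tail′ w j∈n)) (All-at ps j∈n)
  ... | inj₂ refl = subst P (sym (at-head w)) px

  AllPairs-at : ∀ {R : A → A → Set} {n j j′} {w : Vec A n} → VPairs.AllPairs R w →
    1 ≤ j → j < j′ → j′ ≤ n → R (at w j′) (at w j)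
  AllPairs-at [] _ (s≤s _) ()
  AllPairs-at {R} {w = x ∷ w} (Rx ∷ Rw) 1≤j j<j′ j′≤ with InRange-case (≤-trans 1≤j (<⇒≤ j<j′) , j′≤)
  ... | inj₁ (1≤j′ , j′≤n) = subst₂ R (sym (at-tail′ w (1≤j′ , j′≤n))) (sym (at-tail′ w (1≤j , <⇒≤ (<-≤-trans j<j′ j′≤n))))
    (AllPairs-at Rw 1≤j j<j′ j′≤n)
  ... | inj₂ refl = subst₂ R (sym (at-head w)) (sym (at-tail′ w j∈)) (All-at Rx j∈)
    where j∈ = 1≤j , ≤-pred j<j′

  module _ {E : ℕ → A → A → Set} where

    word-normal : ∀ n {f} → (∀ m → ¬ E m (f (1 + m)) (f (2 + m))) → IsNormalForm (Swap E) (word n f)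
    word-normal (suc (suc n)) ¬E (_ , here e)  = ¬E n e
    word-normal (suc n)       ¬E (_ , there s) = word-normal n ¬E (_ , s)

    normal-at : ∀ n {m} (w : Vec A n) → IsNormalForm (Swap E) w → 2 + m ≤ n →
      ¬ E m (at w (1 + m)) (at w (2 + m))
    normal-at (suc n) (x ∷ w) nf m≤ e with InRange-case {n} (s≤s z≤n , m≤)
    ... | inj₁ (_ , m≤n) = normal-at n w (λ (_ , s) → nf (_ , there s)) m≤n
      (subst₂ (E _) (at-tail′ w (s≤s z≤n , <⇒≤ m≤n)) (at-tail′ w (s≤s z≤n , m≤n)) e)
    normal-at (suc (suc n)) (x ∷ y ∷ w) nf _ e | inj₂ refl = nf (_ , here (subst₂ (E n)
      (trans (at-tail′ (y ∷ w) InRange-last) (at-head w)) (at-head {x = x} (y ∷ w)) e))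

-- Row lengths of a partition

part-antitone : ∀ {p} → IsPartition p → ∀ {i i′} → 1 ≤ i → i ≤ i′ → part p i′ ≤ part p i
part-antitone {p} part-≤ (s≤s {n = i} _) i≤i′ = go (≤⇒≤′ i≤i′)
  where
  go : ∀ {i′} → suc i ≤′ i′ → part p i′ ≤ part p (suc i)
  go ≤′-refl                   = ≤-refl
  go (≤′-step {zero} (≤′-reflexive ()))
  go (≤′-step {suc n} i≤′n) = ≤-trans (part-≤ n) (go i≤′n)

part-beyond : ∀ p {i} → length p < i → part p i ≡ 0
part-beyond []      {suc i}       _         = refl
part-beyond (x ∷ p) {suc (suc i)} (s≤s lt) = part-beyond p lt

part≤sum : ∀ p i → part p i ≤ sum p
part≤sum p       zero          = z≤n
part≤sum []      (suc i)       = z≤n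
part≤sum (x ∷ p) (suc zero)    = m≤m+n x (sum p)
part≤sum (x ∷ p) (suc (suc i)) = ≤-trans (part≤sum p (suc i)) (m≤n+m (sum p) x)

-- Column types and their exchanges

data Letter : Set where
  none one two : Letter
  mix          : (p q : ℕ) → Letter

flip : Letter → Letter
flip one = two
flip two = one
flip l   = l

flip-involutive : ∀ l → flip (flip l) ≡ l
flip-involutive none      = refl
flip-involutive one       = refl
flip-involutive two       = refl
flip-involutive (mix p q) = refl

-- The order aimed at along a row: only `a`, mixed, only `b`. Mixed letters share a rank, so no two
-- of them are ever exchanged.
rank : Letter → ℕ
rank none      = 1
rank one       = 0
rank two       = 2
rank (mix p q) = 1

containsA containsB : Letter → Bool
containsA none      = false
containsA one       = true
containsA two       = false
containsA (mix p q) = true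
containsB = containsA ∘ flip

-- With `i′ = i` this is the correction term for `ex` in row `i`, with `i′ = suc i` the one for
-- `ceq`.
isMix : ℕ → ℕ → Letter → Bool
isMix i i′ (mix p q) = (p ≡ᵇ i) ∧ (q ≡ᵇ i′)
isMix i i′ _         = false

isMix-flip : ∀ {i i′} l → isMix i i′ (flip l) ≡ isMix i i′ l
isMix-flip none      = refl
isMix-flip one       = refl
isMix-flip two       = refl
isMix-flip (mix p q) = refl

-- In mix p q, row p is the last one containing a and row q the first one
-- containing b.
hasA hasB : Letter → ℕ → Bool
hasA none      i = false
hasA one       i = true
hasA two       i = false
hasA (mix p q) i = i ≤ᵇ p
hasB none      i = false
hasB one       i = false
hasB two       i = true
hasB (mix p q) i = q ≤ᵇ i

Region : Set
Region = ℕ → ℕ → Bool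

Fits : Region → ℕ → ℕ → ℕ → Set
Fits g p q j = g p j ≡ true × g q j ≡ true

-- `one` and `two` require a region box in the column, so that the traces determine the letter
-- (`describes-unique`).
Valid : Region → ℕ → Letter → Set
Valid g j none      = ∀ i → g i j ≡ false
Valid g j one       = ∃ λ i → g i j ≡ true
Valid g j two       = ∃ λ i → g i j ≡ true
Valid g j (mix p q) = (p ≤ q × q ≤ suc p) × Fits g p q j

Valid-flip : ∀ {g j} l → Valid g j l → Valid g j (flip l)
Valid-flip none      v = v
Valid-flip one       v = v
Valid-flip two       v = v
Valid-flip (mix p q) v = v

hasA∨hasB : ∀ {g i j} l → Valid g j l → g i j ≡ true → hasA l i ∨ hasB l i ≡ true
hasA∨hasB {g} {i} none v gij with () ← trans (sym (v i)) gij
hasA∨hasB one v gij = refl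
hasA∨hasB two v gij = refl
hasA∨hasB {i = i} (mix p q) ((_ , q≤1+p) , _) gij with i ≤? p
... | yes i≤p rewrite true-≤ᵇ i≤p = refl
... | no  i≰p = ∨-trueʳ (i ≤ᵇ p) (true-≤ᵇ (≤-trans q≤1+p (≰⇒> i≰p)))

-- The descents that are resolved by trading places: without the condition on
-- the region the two columns would not be comparable.
data Exchange (g : Region) (n : ℕ) : Letter → Letter → Set where
  mix-one : ∀ {p q} → Fits g p q (1 + n) → Fits g p q (2 + n) → Exchange g n (mix p q) one
  two-mix : ∀ {p q} → Fits g p q (1 + n) → Fits g p q (2 + n) → Exchange g n two (mix p q)
  two-one : ∀ {i} → g i (1 + n) ≡ true → g i (2 + n) ≡ true → Exchange g n two one

exchange-rank : ∀ {g n y x} → Exchange g n y x → rank x < rank y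
exchange-rank (mix-one _ _) = s≤s z≤n
exchange-rank (two-mix _ _) = s≤s (s≤s z≤n)
exchange-rank (two-one _ _) = s≤s z≤n

-- Ranks drop strictly from `z` to `y` to `x`, which leaves `two`, `mix p q`, `one`. The two
-- exchanges together place rows `p` and `q` in the region of all three columns, enough for every
-- exchange required.
exchange-braid : ∀ {g n z y x} → Exchange g n z y → Exchange g (suc n) y x →
  (Exchange g n z x × Exchange g (suc n) z x) × (Exchange g (suc n) z y × Exchange g n y x)
exchange-braid (two-mix f₁ f₂) (mix-one _ f₃) =
  (two-one (proj₁ f₁) (proj₁ f₂) , two-one (proj₁ f₂) (proj₁ f₃)) , (two-mix f₂ f₃ , mix-one f₁ f₂)

exchange-flip : ∀ {g n y x} → Exchange g n y x → Exchange g n (flip x) (flip y)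
exchange-flip (mix-one f f′) = two-mix f f′
exchange-flip (two-mix f f′) = mix-one f f′
exchange-flip (two-one r r′) = two-one r r′

exchange-cong : ∀ {g h} → (∀ i j → g i j ≡ h i j) → ∀ {n y x} → Exchange g n y x → Exchange h n y x
exchange-cong {g} {h} g≗h = go
  where
  via : ∀ {i j} → g i j ≡ true → h i j ≡ true
  via {i} {j} = trans (sym (g≗h i j))
  go : ∀ {n y x} → Exchange g n y x → Exchange h n y x
  go (mix-one (r , s) (r′ , s′)) = mix-one (via r , via s) (via r′ , via s′)
  go (two-mix (r , s) (r′ , s′)) = two-mix (via r , via s) (via r′ , via s′)
  go (two-one r r′)              = two-one (via r) (via r′)

-- An exchange records region boxes in both columns, so each letter is valid where it arrives.
exchange-valid : ∀ {g n x y} → Exchange g n y x → Valid g (1 + n) y → Valid g (2 + n) x →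
  Valid g (1 + n) x × Valid g (2 + n) y
exchange-valid (mix-one f f′) (pq , _) _ = (_ , proj₁ f) , (pq , f′)
exchange-valid (two-mix f f′) _ (pq , _) = (pq , f) , (_ , proj₁ f′)
exchange-valid (two-one r r′) _ _        = (_ , r) , (_ , r′)

-- The first argument is the column further to the right.
Separated : Letter → Letter → Set
Separated (mix p′ q′) (mix p q) = p′ < q
Separated _           _         = ⊤

-- No exchange involves two mixed letters. As `Separated` refers to letters and not to columns, it
-- survives sorting.
exchange-separated : ∀ {g n x y} → Exchange g n y x → Separated y x
exchange-separated (mix-one _ _) = tt
exchange-separated (two-mix _ _) = tt
exchange-separated (two-one _ _) = tt

Separated-flip : ∀ x y → Separated x y → Separated (flip x) (flip y)
Separated-flip (mix _ _) (mix _ _) s = s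
Separated-flip (mix _ _) none      s = tt
Separated-flip (mix _ _) one       s = tt
Separated-flip (mix _ _) two       s = tt
Separated-flip none      _         s = tt
Separated-flip one       _         s = tt
Separated-flip two       _         s = tt

module _ {g : Region} {R : ℕ} (bounded : ∀ i j → g i j ≡ true → InRange R i) where

  private
    shared? : ∀ n → Dec (∃ λ i → g i (1 + n) ≡ true × g i (2 + n) ≡ true)
    shared? n with anyTo R (λ i → g i (1 + n) ∧ g i (2 + n)) in eq
    ... | true  = let i , _ , gg = anyTo⁻ R eq in yes (i , ∧-trueˡ gg , ∧-trueʳ {g i (1 + n)} gg)
    ... | false = no λ (i , r , r′) → contradiction
      (trans (sym eq) (anyTo⁺ {p = λ i → g i (1 + n) ∧ g i (2 + n)} (bounded _ _ r) (cong₂ _∧_ r r′))) λ ()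

    fits? : ∀ p q j → Dec (Fits g p q j)
    fits? p q j = (g p j ≟ᵇ true) ×-dec (g q j ≟ᵇ true)

  exchange? : ∀ n y x → Dec (Exchange g n y x)
  exchange? n two one = map′ (λ (_ , r , r′) → two-one r r′) (λ { (two-one r r′) → _ , r , r′ }) (shared? n)
  exchange? n (mix p q) one = map′ (uncurry mix-one) (λ { (mix-one f f′) → f , f′ })
    (fits? p q (1 + n) ×-dec fits? p q (2 + n))
  exchange? n two (mix p q) = map′ (uncurry two-mix) (λ { (two-mix f f′) → f , f′ })
    (fits? p q (1 + n) ×-dec fits? p q (2 + n))
  exchange? n none      x         = no λ ()
  exchange? n one       x         = no λ ()
  exchange? n two       none      = no λ ()
  exchange? n two       two       = no λ ()
  exchange? n (mix p q) none      = no λ ()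
  exchange? n (mix p q) two       = no λ ()
  exchange? n (mix p q) (mix _ _) = no λ ()

-- Flipping words and reading off the type of a column

open Words none

flip-Swap : ∀ {g n} {v w : Vec Letter n} → Swap (Exchange g) v w → Swap (Exchange g) (Vec.map flip w) (Vec.map flip v)
flip-Swap (here e)  = here (exchange-flip e)
flip-Swap (there s) = there (flip-Swap s)

map-flip-involutive : ∀ {n} (w : Vec Letter n) → Vec.map flip (Vec.map flip w) ≡ w
map-flip-involutive []      = refl
map-flip-involutive (x ∷ w) = cong₂ _∷_ (flip-involutive x) (map-flip-involutive w)

letterFrom : Bool → Bool → ℕ → ℕ → Letter
letterFrom false false p q = none
letterFrom true  false p q = one
letterFrom false true  p q = two
letterFrom true  true  p q = mix p q

-- The letter of a column whose boxes containing a and b are given by f and g.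
columnLetter : ℕ → (f g : ℕ → Bool) → Letter
columnLetter R f g = letterFrom (anyTo R f) (anyTo R g) (lastTo R f) (firstTo R g)

columnLetter-cong : ∀ R {f f′ g g′} → (∀ i → f i ≡ f′ i) → (∀ i → g i ≡ g′ i) →
  columnLetter R f g ≡ columnLetter R f′ g′
columnLetter-cong R f≗f′ g≗g′
  rewrite anyTo-cong R f≗f′ | anyTo-cong R g≗g′ | lastTo-cong R f≗f′ | firstTo-cong R g≗g′ = refl

-- A letter says where `a` and `b` occur only relative to the region `f i ∨ g i`; region and letter
-- together determine both traces.
record Describes (f g : ℕ → Bool) (valid : Letter → Set) (l : Letter) : Set where
  field
    has-a : ∀ i → f i ≡ (f i ∨ g i) ∧ hasA l i
    has-b : ∀ i → g i ≡ (f i ∨ g i) ∧ hasB l i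
    is-valid : valid l

-- Geometry of the skew shape

module Shape (la mu : List ℕ) (la-part : IsPartition la) (mu-part : IsPartition mu) where

  R N : ℕ
  R = length la
  N = sum la

  Box : ℕ → ℕ → Set
  Box = InSkew la mu

  inB⇒Box : ∀ i j → inB la mu i j ≡ true → Box i j
  inB⇒Box i j eq = <ᵇ⇒< _ _ (Equivalence.from T-≡ (∧-trueˡ eq)) , ≤ᵇ-true (∧-trueʳ {part mu i <ᵇ j} eq)

  Box⇒inB : ∀ i j → Box i j → inB la mu i j ≡ true
  Box⇒inB i j (lt , le) = cong₂ _∧_ (Equivalence.to T-≡ (<⇒<ᵇ lt)) (true-≤ᵇ le)

  Box⇒row : ∀ i {j} → Box i j → InRange R i
  Box⇒row zero    (lt , le) = contradiction (<-≤-trans lt le) λ ()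
  Box⇒row (suc i) (lt , le) = s≤s z≤n , ≮⇒≥ λ R<i →
    contradiction (<-≤-trans lt (subst (_ ≤_) (part-beyond la R<i) le)) λ ()

  Box⇒column : ∀ i {j} → Box i j → InRange N j
  Box⇒column i (lt , le) = ≤-trans (s≤s z≤n) lt , ≤-trans le (part≤sum la i)

  Box-between : ∀ {i j i′ j′ r c} → Box i j → Box i′ j′ → i ≤ r → r ≤ i′ → j ≤ c → c ≤ j′ → Box r c
  Box-between {i} box@(lt , _) (_ , le) i≤r r≤i′ j≤c c≤j′ =
    ≤-<-trans (part-antitone mu-part 1≤i i≤r) (<-≤-trans lt j≤c) ,
    ≤-trans c≤j′ (≤-trans le (part-antitone la-part (≤-trans 1≤i i≤r) r≤i′))
    where 1≤i = proj₁ (Box⇒row i box)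

  has : ℕ → Filling → Region
  has c F i j = inB la mu i j ∧ memB c (F i j)

  Has⁻ : ∀ c F i j → has c F i j ≡ true → Box i j × c ∈ F i j
  Has⁻ c F i j eq = inB⇒Box i j (∧-trueˡ eq) , memB⇒∈ (∧-trueʳ {inB la mu i j} eq)

  Has⁺ : ∀ c F i j → Box i j → c ∈ F i j → has c F i j ≡ true
  Has⁺ c F i j box c∈ = cong₂ _∧_ (Box⇒inB i j box) (∈⇒memB c∈)

  has-cong : ∀ {F G} → SameOn la mu F G → ∀ c i j → has c F i j ≡ has c G i j
  has-cong {F} {G} same c i j with inB la mu i j in eq
  ... | false = refl
  ... | true  = cong (memB c) (same i j (inB⇒Box i j eq))

-- Letters compared with the traces that they describe

map-word : ∀ n {f} → Vec.map flip (word n f) ≡ word n (flip ∘ f)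
map-word zero    = refl
map-word (suc n) {f} = cong (flip (f (suc n)) ∷_) (map-word n)

Valid-cong : ∀ {g h j} → (∀ i → g i j ≡ h i j) → ∀ l → Valid g j l → Valid h j l
Valid-cong g≗h none      v = λ i → trans (sym (g≗h i)) (v i)
Valid-cong g≗h one       (i , v) = i , trans (sym (g≗h i)) v
Valid-cong g≗h two       (i , v) = i , trans (sym (g≗h i)) v
Valid-cong g≗h (mix p q) (pq , gp , gq) = pq , trans (sym (g≗h p)) gp , trans (sym (g≗h q)) gq

hasB-hasA⇒≤ : ∀ {g j i i′} l → Valid g j l → hasB l i ≡ true → hasA l i′ ≡ true → i′ ≤ i
hasB-hasA⇒≤ (mix p q) ((p≤q , _) , _) b≤ ≤a = ≤-trans (≤ᵇ-true ≤a) (≤-trans p≤q (≤ᵇ-true b≤))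

isMix-region : ∀ {g i i′ j} l → Valid g j l → isMix i i′ l ≡ true → g i j ≡ true × g i′ j ≡ true
isMix-region {i = i} (mix p q) (_ , fits) eq
  with refl ← ≡ᵇ-true {p} {i} (∧-trueˡ eq) | refl ← ≡ᵇ-true {q} (∧-trueʳ {p ≡ᵇ i} eq) = fits

hasA∧hasB : ∀ {g i j} l → Valid g j l → hasA l i ∧ hasB l i ≡ isMix i i l
hasA∧hasB none _ = refl
hasA∧hasB one  _ = refl
hasA∧hasB two  _ = refl
hasA∧hasB {i = i} (mix p q) ((p≤q , _) , _) = bool-ext to from
  where
  to : (i ≤ᵇ p) ∧ (q ≤ᵇ i) ≡ true → (p ≡ᵇ i) ∧ (q ≡ᵇ i) ≡ true
  to eq = cong₂ _∧_ (true-≡ᵇ (≤-antisym (≤-trans p≤q q≤i) i≤p)) (true-≡ᵇ (≤-antisym q≤i (≤-trans i≤p p≤q)))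
    where
    i≤p = ≤ᵇ-true (∧-trueˡ eq)
    q≤i = ≤ᵇ-true (∧-trueʳ {i ≤ᵇ p} eq)
  from : (p ≡ᵇ i) ∧ (q ≡ᵇ i) ≡ true → (i ≤ᵇ p) ∧ (q ≤ᵇ i) ≡ true
  from eq = cong₂ _∧_ (true-≤ᵇ (≤-reflexive (sym (≡ᵇ-true {p} (∧-trueˡ eq)))))
    (true-≤ᵇ (≤-reflexive (≡ᵇ-true {q} (∧-trueʳ {p ≡ᵇ i} eq))))

-- In `mix p q`, if `suc i` lies beyond the last `a` and `i` before the first `b`, then `q ≤ suc p`
-- forces `p = i` and `q = suc i`, the excluded case.
unmixed : ∀ {g i j} l → Valid g j l → g i j ≡ true → isMix i (suc i) l ≡ false →
  (hasA l i ≡ true × hasA l (suc i) ≡ true) ⊎ (hasB l i ≡ true × hasB l (suc i) ≡ true)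
unmixed {i = i} none v gij _ with () ← trans (sym (v i)) gij
unmixed one _ _ _ = inj₁ (refl , refl)
unmixed two _ _ _ = inj₂ (refl , refl)
unmixed {i = i} (mix p q) ((p≤q , q≤1+p) , _) _ not-mix with suc i ≤? p | q ≤? i
... | yes i<p | _       = inj₁ (true-≤ᵇ (<⇒≤ i<p) , true-≤ᵇ i<p)
... | no _    | yes q≤i = inj₂ (true-≤ᵇ q≤i , true-≤ᵇ (m≤n⇒m≤1+n q≤i))
... | no i≮p  | no q≰i  = contradiction
  (trans (sym (cong₂ _∧_ (true-≡ᵇ p≡i) (true-≡ᵇ (≤-antisym (≤-trans q≤1+p (s≤s (≤-reflexive p≡i))) (≰⇒> q≰i))))) not-mix) λ ()
  where
  p≡i : p ≡ i
  p≡i = ≤-antisym (≮⇒≥ i≮p) (≤-pred (≤-trans (≰⇒> q≰i) q≤1+p))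

module _ {f g : ℕ → Bool} {region : Region} {j : ℕ} (region-j : ∀ i → region i j ≡ f i ∨ g i) where

  private
    Desc : Letter → Set
    Desc = Describes f g (Valid region j)

  describes-a : ∀ {l} → Desc l → ∀ {i} → region i j ≡ true → hasA l i ≡ true → f i ≡ true
  describes-a d {i} r a = trans (Describes.has-a d i) (cong₂ _∧_ (trans (sym (region-j i)) r) a)

  describes-b : ∀ {l} → Desc l → ∀ {i} → region i j ≡ true → hasB l i ≡ true → g i ≡ true
  describes-b d {i} r b = trans (Describes.has-b d i) (cong₂ _∧_ (trans (sym (region-j i)) r) b)

  describes-a⁻ : ∀ {l} → Desc l → ∀ {i} → f i ≡ true → hasA l i ≡ true
  describes-a⁻ d {i} fi = ∧-trueʳ {f i ∨ g i} (trans (sym (Describes.has-a d i)) fi)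

  describes-b⁻ : ∀ {l} → Desc l → ∀ {i} → g i ≡ true → hasB l i ≡ true
  describes-b⁻ d {i} gi = ∧-trueʳ {f i ∨ g i} (trans (sym (Describes.has-b d i)) gi)

  -- Identifies the letter read off a new filling with the letter from which that column was built.
  describes-unique : ∀ {l l′} → Desc l → Desc l′ → l ≡ l′
  describes-unique {l} {l′} d d′ = go l l′ d d′ (Describes.is-valid d) (Describes.is-valid d′)
    where
    empty : ∀ {i} → region i j ≡ false → region i j ≡ true → ⊥
    empty r≡false r≡true with () ← trans (sym r≡false) r≡true
    transferA : ∀ {l l′} → Desc l → Desc l′ → ∀ {i} → region i j ≡ true → hasA l i ≡ true → hasA l′ i ≡ true
    transferA d d′ r a = describes-a⁻ d′ (describes-a d r a)
    transferB : ∀ {l l′} → Desc l → Desc l′ → ∀ {i} → region i j ≡ true → hasB l i ≡ true → hasB l′ i ≡ true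
    transferB d d′ r b = describes-b⁻ d′ (describes-b d r b)
    go : ∀ l l′ → Desc l → Desc l′ → Valid region j l → Valid region j l′ → l ≡ l′
    go none none _ _ _ _ = refl
    go none one _ _ v (i , r) = ⊥-elim (empty (v i) r)
    go none two _ _ v (i , r) = ⊥-elim (empty (v i) r)
    go none (mix p q) _ _ v (_ , r , _) = ⊥-elim (empty (v p) r)
    go one none _ _ (i , r) v = ⊥-elim (empty (v i) r)
    go two none _ _ (i , r) v = ⊥-elim (empty (v i) r)
    go (mix p q) none _ _ (_ , r , _) v = ⊥-elim (empty (v p) r)
    go one one _ _ _ _ = refl
    go two two _ _ _ _ = refl
    go one two d d′ (i , r) _ with () ← transferA d d′ r refl
    go two one d d′ (i , r) _ with () ← transferA d′ d r refl
    go one (mix p q) d d′ _ (_ , _ , r) with () ← transferB d′ d r (true-≤ᵇ (≤-refl {q}))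
    go two (mix p q) d d′ _ (_ , r , _) with () ← transferA d′ d r (true-≤ᵇ (≤-refl {p}))
    go (mix p q) one d d′ (_ , _ , r) _ with () ← transferB d d′ r (true-≤ᵇ (≤-refl {q}))
    go (mix p q) two d d′ (_ , r , _) _ with () ← transferA d d′ r (true-≤ᵇ (≤-refl {p}))
    go (mix p q) (mix p′ q′) d d′ (_ , rp , rq) (_ , rp′ , rq′) = cong₂ mix
      (≤-antisym (≤ᵇ-true (transferA d d′ rp (true-≤ᵇ (≤-refl {p})))) (≤ᵇ-true (transferA d′ d rp′ (true-≤ᵇ (≤-refl {p′})))))
      (≤-antisym (≤ᵇ-true (transferB d′ d rq′ (true-≤ᵇ (≤-refl {q′})))) (≤ᵇ-true (transferB d d′ rq (true-≤ᵇ (≤-refl {q})))))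

-- The transposition of `k` and `suc k` on exponent indices; index `k` belongs to the entry `suc k`,
-- the `a` of `Involution`.
adjacent : ℕ → ℕ → ℕ
adjacent k m with m ≟ k | m ≟ suc k
... | yes _ | _     = suc k
... | no _  | yes _ = k
... | no _  | no _  = m

-- The involution exchanging two neighbouring variables

module Involution (la mu : List ℕ) (la-part : IsPartition la) (mu-part : IsPartition mu) (k : ℕ) where

  open Shape la mu la-part mu-part

  a : ℕ
  a = suc k

  open Replace a

  region : Filling → Region
  region F i j = has a F i j ∨ has b F i j

  region⁻ : ∀ F i j → region F i j ≡ true → Box i j × (a ∈ F i j ⊎ b ∈ F i j)
  region⁻ F i j r with ∨-true {has a F i j} r
  ... | inj₁ ha = let box , a∈ = Has⁻ a F i j ha in box , inj₁ a∈
  ... | inj₂ hb = let box , b∈ = Has⁻ b F i j hb in box , inj₂ b∈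

  region⁺ : ∀ F i j → Box i j → (a ∈ F i j ⊎ b ∈ F i j) → region F i j ≡ true
  region⁺ F i j box (inj₁ a∈) rewrite Has⁺ a F i j box a∈ = refl
  region⁺ F i j box (inj₂ b∈) = ∨-trueʳ (has a F i j) (Has⁺ b F i j box b∈)

  has-a⇒region : ∀ F i j → has a F i j ≡ true → region F i j ≡ true
  has-a⇒region F i j eq rewrite eq = refl

  has-b⇒region : ∀ F i j → has b F i j ≡ true → region F i j ≡ true
  has-b⇒region F i j = ∨-trueʳ (has a F i j)

  region-bounded : ∀ F i j → region F i j ≡ true → InRange R i
  region-bounded F i j r = Box⇒row i (proj₁ (region⁻ F i j r))

  region-cong : ∀ {F G} → SameOn la mu F G → ∀ i j → region F i j ≡ region G i j
  region-cong same i j = cong₂ _∨_ (has-cong same a i j) (has-cong same b i j)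

  letterOf : Filling → ℕ → Letter
  letterOf F j = columnLetter R (λ i → has a F i j) (λ i → has b F i j)

  encode : Filling → Vec Letter N
  encode F = word N (letterOf F)

  module Sort (F : Filling) = Sorting (Exchange (region F)) (exchange? (region-bounded F)) rank exchange-rank exchange-braid

  newWord : Filling → Vec Letter N
  newWord F = Sort.norm F (Vec.map flip (encode F))

  newLetter : Filling → ℕ → Letter
  newLetter F = at (newWord F)

  act : Filling → Filling
  act F i j = if region F i j
    then replace (hasA (newLetter F j) i) (hasB (newLetter F j) i) (F i j)
    else F i j

  Normal-cong : ∀ F G → (∀ i j → region F i j ≡ region G i j) → ∀ {n} {w : Vec Letter n} →
    Sort.Normal F w → Sort.Normal G w
  Normal-cong F G F≗G nf (_ , s) = nf (_ , Swap-map (exchange-cong λ i j → sym (F≗G i j)) s)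

  -- The two regions agree only pointwise, so the rewriting systems are not identified; steps are
  -- carried from one to the other and uniqueness of normal forms does the rest.
  newWord-cong : ∀ {F G} → SameOn la mu F G → newWord F ≡ newWord G
  newWord-cong {F} {G} same = trans
    (cong (Sort.norm F ∘ Vec.map flip) (word-cong N λ j →
      columnLetter-cong R (λ i → has-cong same a i j) (λ i → has-cong same b i j)))
    (Sort.norm-unique F
      (Star.map (Swap-map (exchange-cong λ i j → sym (F≗G i j))) (Sort.norm-↠ G w))
      (Normal-cong G F (λ i j → sym (F≗G i j)) (Sort.norm-normal G w)))
    where
    w = Vec.map flip (encode G)
    F≗G = region-cong same

  act-cong : ∀ {F G} → SameOn la mu F G → SameOn la mu (act F) (act G)
  act-cong {F} {G} same i j box
    rewrite region-cong same i j | newWord-cong same | same i j box = refl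

  Desc : Filling → ℕ → Letter → Set
  Desc F j = Describes (λ i → has a F i j) (λ i → has b F i j) (Valid (region F) j)

  any-a : ∀ H j {l} → Desc H j l → anyTo R (λ i → has a H i j) ≡ containsA l
  any-a H j {l} d = bool-ext (to l d) (λ c → found (from l d c))
    where
    found : (∃ λ i → has a H i j ≡ true) → anyTo R (λ i → has a H i j) ≡ true
    found (i , h) = anyTo⁺ {p = λ i → has a H i j} (region-bounded H i j (has-a⇒region H i j h)) h
    to : ∀ l → Desc H j l → anyTo R (λ i → has a H i j) ≡ true → containsA l ≡ true
    to l d any with anyTo⁻ R any
    to none      d any | i , _ , h with () ← describes-a⁻ (λ _ → refl) d h
    to two       d any | i , _ , h with () ← describes-a⁻ (λ _ → refl) d h
    to one       d any | _ = refl
    to (mix p q) d any | _ = refl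
    from : ∀ l → Desc H j l → containsA l ≡ true → ∃ λ i → has a H i j ≡ true
    from one       d _ = let i , r = Describes.is-valid d in i , describes-a (λ _ → refl) d r refl
    from (mix p q) d _ = let _ , r , _ = Describes.is-valid d in p , describes-a (λ _ → refl) d r (true-≤ᵇ (≤-refl {p}))

  any-b : ∀ H j {l} → Desc H j l → anyTo R (λ i → has b H i j) ≡ containsB l
  any-b H j {l} d = bool-ext (to l d) (λ c → found (from l d c))
    where
    found : (∃ λ i → has b H i j ≡ true) → anyTo R (λ i → has b H i j) ≡ true
    found (i , h) = anyTo⁺ {p = λ i → has b H i j} (region-bounded H i j (has-b⇒region H i j h)) h
    to : ∀ l → Desc H j l → anyTo R (λ i → has b H i j) ≡ true → containsB l ≡ true
    to l d any with anyTo⁻ R any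
    to none      d any | i , _ , h with () ← describes-b⁻ (λ _ → refl) d h
    to one       d any | i , _ , h with () ← describes-b⁻ (λ _ → refl) d h
    to two       d any | _ = refl
    to (mix p q) d any | _ = refl
    from : ∀ l → Desc H j l → containsB l ≡ true → ∃ λ i → has b H i j ≡ true
    from two       d _ = let i , r = Describes.is-valid d in i , describes-b (λ _ → refl) d r refl
    from (mix p q) d _ = let _ , _ , r = Describes.is-valid d in q , describes-b (λ _ → refl) d r (true-≤ᵇ (≤-refl {q}))

  link : Filling → Region
  link H i j = inB la mu i j ∧ inB la mu (suc i) j ∧ (maxL (H i j) ≡ᵇ minL (H (suc i) j))

  excess : Filling → ℕ → ℕ → ℕ
  excess H i j = if inB la mu i j then length (H i j) ∸ 1 else 0

  -- Order and convexity in an SVRPP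

  module Properties {F : Filling} (svrpp : IsSVRPP la mu F) where

    open IsSVRPP svrpp

    inhabited : ∀ i j → Box i j → ∃ (_∈ F i j)
    inhabited i j box = ValidSet⇒∈ (valid i j box)

    ordered : ∀ i j i′ j′ → Box i j → Box i′ j′ → i ≤ i′ → j ≤ j′ →
      (i ≡ i′ × j ≡ j′) ⊎ (∀ {x y} → x ∈ F i j → y ∈ F i′ j′ → x ≤ y)
    ordered i j i′ j′ box box′ i≤i′ j≤j′ with m≤n⇒m<n∨m≡n i≤i′ | m≤n⇒m<n∨m≡n j≤j′
    ... | inj₂ refl | inj₂ refl = inj₁ (refl , refl)
    ... | inj₂ refl | inj₁ j<j′ = inj₂ (≤S⇒≤ (rows i j j′ j<j′ box box′))
    ... | inj₁ i<i′ | inj₂ refl = inj₂ (≤S⇒≤ (cols i i′ j i<i′ box box′))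
    -- The corner `(i , j′)` belongs to the skew shape, and any entry there mediates between the two
    -- boxes.
    ... | inj₁ i<i′ | inj₁ j<j′ = inj₂ λ x∈ y∈ →
      let corner  = Box-between box box′ ≤-refl i≤i′ j≤j′ ≤-refl
          z , z∈ = inhabited i j′ corner
      in ≤-trans (≤S⇒≤ (rows i j j′ j<j′ box corner) x∈ z∈) (≤S⇒≤ (cols i i′ j′ i<i′ corner box′) z∈ y∈)

    no-ba : ∀ i j i′ j′ → i ≤ i′ → j ≤ j′ → i ≢ i′ ⊎ j ≢ j′ →
      has b F i j ≡ true → has a F i′ j′ ≡ true → ⊥
    no-ba i j i′ j′ i≤i′ j≤j′ distinct hb ha with Has⁻ b F i j hb | Has⁻ a F i′ j′ ha
    ... | box , b∈ | box′ , a∈ with ordered i j i′ j′ box box′ i≤i′ j≤j′ | distinct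
    ...   | inj₂ le          | _        = <-irrefl refl (le b∈ a∈)
    ...   | inj₁ (i≡ , _)    | inj₁ i≢ = i≢ i≡
    ...   | inj₁ (_ , j≡)    | inj₂ j≢ = j≢ j≡

    a≤region : ∀ {z} i j i′ j′ → region F i j ≡ true → Box i′ j′ → i ≤ i′ → j ≤ j′ → z ∈ F i′ j′ →
      region F i′ j′ ≡ true ⊎ a ≤ z
    a≤region i j i′ j′ r box′ i≤i′ j≤j′ z∈ with region⁻ F i j r
    ... | box , c∈ with ordered i j i′ j′ box box′ i≤i′ j≤j′ | c∈
    ...   | inj₁ (refl , refl) | _       = inj₁ r
    ...   | inj₂ le            | inj₁ a∈ = inj₂ (le a∈ z∈)
    ...   | inj₂ le            | inj₂ b∈ = inj₂ (<⇒≤ (le b∈ z∈))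

    region≤b : ∀ {z} i j i′ j′ → region F i′ j′ ≡ true → Box i j → i ≤ i′ → j ≤ j′ → z ∈ F i j →
      region F i j ≡ true ⊎ z ≤ b
    region≤b i j i′ j′ r box i≤i′ j≤j′ z∈ with region⁻ F i′ j′ r
    ... | box′ , c∈ with ordered i j i′ j′ box box′ i≤i′ j≤j′ | c∈
    ...   | inj₁ (refl , refl) | _       = inj₁ r
    ...   | inj₂ le            | inj₁ a∈ = inj₂ (m≤n⇒m≤1+n (le z∈ a∈))
    ...   | inj₂ le            | inj₂ b∈ = inj₂ (le z∈ b∈)

    -- Unless the box is one of the two ends, its entries lie between `a` and `b`; these are
    -- consecutive, so any entry is one of them.
    region-convex : ∀ {i j i′ j′} r c → region F i j ≡ true → region F i′ j′ ≡ true →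
      i ≤ r → r ≤ i′ → j ≤ c → c ≤ j′ → region F r c ≡ true
    region-convex {i} {j} {i′} {j′} r c reg reg′ i≤r r≤i′ j≤c c≤j′
      with Box-between (proj₁ (region⁻ F i j reg)) (proj₁ (region⁻ F i′ j′ reg′)) i≤r r≤i′ j≤c c≤j′
    ... | box with inhabited r c box
    ...   | z , z∈ with a≤region i j r c reg box i≤r j≤c z∈ | region≤b r c i′ j′ reg′ box r≤i′ c≤j′ z∈
    ...     | inj₁ done | _         = done
    ...     | inj₂ _    | inj₁ done = done
    ...     | inj₂ a≤z  | inj₂ z≤b with m≤n⇒m<n∨m≡n a≤z
    ...       | inj₂ refl = region⁺ F r c box (inj₁ z∈)
    ...       | inj₁ a<z with refl ← ≤-antisym z≤b a<z = region⁺ F r c box (inj₂ z∈)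

    absent : ∀ c j → anyTo R (λ i → has c F i j) ≡ false → ∀ i → has c F i j ≡ false
    absent c j nowhere i = ¬-not λ h → contradiction
      (trans (sym nowhere) (anyTo⁺ {p = λ i → has c F i j} (Box⇒row i (proj₁ (Has⁻ c F i j h))) h)) λ ()

    letterOf-describes : ∀ j → Desc F j (letterOf F j)
    letterOf-describes j with anyTo R (λ i → has a F i j) in anyA | anyTo R (λ i → has b F i j) in anyB
    ... | false | false = record
      { has-a    = λ i → trans (absent a j anyA i) (sym (∧-zeroʳ _))
      ; has-b    = λ i → trans (absent b j anyB i) (sym (∧-zeroʳ _))
      ; is-valid = λ i → cong₂ _∨_ (absent a j anyA i) (absent b j anyB i) }
    ... | true | false = record
      { has-a    = λ i → sym (trans (∧-identityʳ _) (trans (cong (has a F i j ∨_) (absent b j anyB i)) (∨-identityʳ _)))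
      ; has-b    = λ i → trans (absent b j anyB i) (sym (∧-zeroʳ _))
      ; is-valid = let i , _ , h = anyTo⁻ R anyA in i , has-a⇒region F i j h }
    ... | false | true = record
      { has-a    = λ i → trans (absent a j anyA i) (sym (∧-zeroʳ _))
      ; has-b    = λ i → sym (trans (∧-identityʳ _) (cong (_∨ has b F i j) (absent a j anyA i)))
      ; is-valid = let i , _ , h = anyTo⁻ R anyB in i , has-b⇒region F i j h }
    ... | true | true = record
      { has-a    = λ i → bool-ext (λ h → cong₂ _∧_ (has-a⇒region F i j h) (true-≤ᵇ (≤last h))) (a-upTo-last i)
      ; has-b    = λ i → bool-ext (λ h → cong₂ _∧_ (has-b⇒region F i j h) (true-≤ᵇ (first≤ h))) (b-from-first i)
      ; is-valid = (p≤q , ≮⇒≥ consecutive) , has-a⇒region F p j last-a , has-b⇒region F q j first-b }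
      where
      p = lastTo R (λ i → has a F i j)
      q = firstTo R (λ i → has b F i j)
      last-a : has a F p j ≡ true
      last-a = let i , i∈ , h = anyTo⁻ R anyA in proj₂ (lastTo-spec R {p = λ i → has a F i j} i∈ h)
      first-b : has b F q j ≡ true
      first-b = let i , i∈ , h = anyTo⁻ R anyB in proj₂ (firstTo-spec R {p = λ i → has b F i j} i∈ h)
      ≤last : ∀ {i} → has a F i j ≡ true → i ≤ p
      ≤last {i} h = proj₁ (lastTo-spec R {p = λ i → has a F i j} (Box⇒row i (proj₁ (Has⁻ a F i j h))) h)
      first≤ : ∀ {i} → has b F i j ≡ true → q ≤ i
      first≤ {i} h = proj₁ (firstTo-spec R {p = λ i → has b F i j} (Box⇒row i (proj₁ (Has⁻ b F i j h))) h)
      a-upTo-last : ∀ i → region F i j ∧ (i ≤ᵇ p) ≡ true → has a F i j ≡ true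
      a-upTo-last i eq with ∨-true {has a F i j} (∧-trueˡ eq) | m≤n⇒m<n∨m≡n (≤ᵇ-true {i} {p} (∧-trueʳ {region F i j} eq))
      ... | inj₁ h  | _         = h
      ... | inj₂ _  | inj₂ refl = last-a
      ... | inj₂ hb | inj₁ i<p  = ⊥-elim (no-ba i j p j (<⇒≤ i<p) ≤-refl (inj₁ (<⇒≢ i<p)) hb last-a)
      b-from-first : ∀ i → region F i j ∧ (q ≤ᵇ i) ≡ true → has b F i j ≡ true
      b-from-first i eq with ∨-true {has a F i j} (∧-trueˡ eq) | m≤n⇒m<n∨m≡n (≤ᵇ-true {q} {i} (∧-trueʳ {region F i j} eq))
      ... | inj₂ h  | _         = h
      ... | inj₁ _  | inj₂ refl = first-b
      ... | inj₁ ha | inj₁ q<i  = ⊥-elim (no-ba q j i j (<⇒≤ q<i) ≤-refl (inj₁ (<⇒≢ q<i)) first-b ha)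
      p≤q : p ≤ q
      p≤q = ≮⇒≥ λ q<p → no-ba q j p j (<⇒≤ q<p) ≤-refl (inj₁ (<⇒≢ q<p)) first-b last-a
      consecutive : ¬ (suc p < q)
      -- By convexity row `suc p` would lie in the region, although it comes after the last `a` and
      -- before the first `b`.
      consecutive 1+p<q with ∨-true {has a F (suc p) j} (region-convex (suc p) j
        (has-a⇒region F p j last-a) (has-b⇒region F q j first-b) (n≤1+n p) (<⇒≤ 1+p<q) ≤-refl ≤-refl)
      ... | inj₁ ha = <-irrefl refl (≤last ha)
      ... | inj₂ hb = <-irrefl refl (<-≤-trans 1+p<q (first≤ hb))

    -- Every exchange exhibits a row with `b` directly left of `a`: the first `b` of a mixed left
    -- column, the last `a` of a mixed right column, or any shared row for `two` and `one`.
    letters-no-exchange : ∀ n {y x} → Desc F (1 + n) y → Desc F (2 + n) x → ¬ Exchange (region F) n y x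
    letters-no-exchange n dy dx e = conflict e dy dx
      where
      descent : ∀ i {y x} → Desc F (1 + n) y → Desc F (2 + n) x → region F i (1 + n) ≡ true → region F i (2 + n) ≡ true →
        hasB y i ≡ true → hasA x i ≡ true → ⊥
      descent i dy dx r r′ hb ha = no-ba i (1 + n) i (2 + n) ≤-refl (n≤1+n _) (inj₂ (<⇒≢ ≤-refl))
        (describes-b (λ _ → refl) dy r hb) (describes-a (λ _ → refl) dx r′ ha)
      conflict : ∀ {y x} → Exchange (region F) n y x → Desc F (1 + n) y → Desc F (2 + n) x → ⊥
      conflict (mix-one {q = q} (_ , r) (_ , r′)) dy dx = descent q dy dx r r′ (true-≤ᵇ (≤-refl {q})) refl
      conflict (two-mix {p = p} (r , _) (r′ , _)) dy dx = descent p dy dx r r′ refl (true-≤ᵇ (≤-refl {p}))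
      conflict (two-one {i = i} r r′)             dy dx = descent i dy dx r r′ refl refl

    encode-normal : Sort.Normal F (encode F)
    encode-normal = word-normal N λ m → letters-no-exchange m (letterOf-describes (1 + m)) (letterOf-describes (2 + m))

    letters-separated : ∀ {j j′} → j < j′ → ∀ x y → Desc F j′ x → Desc F j y → Separated x y
    letters-separated {j} {j′} j<j′ (mix p′ q′) (mix p q) dx dy = ≰⇒> λ q≤p′ →
      no-ba q j p′ j′ q≤p′ (<⇒≤ j<j′) (inj₂ (<⇒≢ j<j′))
        (describes-b (λ _ → refl) dy (proj₂ (proj₂ (Describes.is-valid dy))) (true-≤ᵇ (≤-refl {q})))
        (describes-a (λ _ → refl) dx (proj₁ (proj₂ (Describes.is-valid dx))) (true-≤ᵇ (≤-refl {p′})))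
    letters-separated _ (mix _ _) none      _ _ = tt
    letters-separated _ (mix _ _) one       _ _ = tt
    letters-separated _ (mix _ _) two       _ _ = tt
    letters-separated _ none      _         _ _ = tt
    letters-separated _ one       _         _ _ = tt
    letters-separated _ two       _         _ _ = tt

    flipped-↠ : Sort._↠_ F (word N (flip ∘ letterOf F)) (newWord F)
    flipped-↠ = subst (λ w → Sort._↠_ F w (newWord F)) (map-word N) (Sort.norm-↠ F (Vec.map flip (encode F)))

    newWord-separated : VPairs.AllPairs Separated (newWord F)
    newWord-separated = AllPairs-Swap exchange-separated flipped-↠ (AllPairs-word N λ {j} {j′} j<j′ →
      Separated-flip (letterOf F j′) (letterOf F j)
        (letters-separated j<j′ _ _ (letterOf-describes j′) (letterOf-describes j)))

    newLetter-valid : ∀ j → Valid (region F) j (newLetter F j)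
    newLetter-valid j with (1 ≤? j) ×-dec (j ≤? N)
    ... | yes j∈ = Columns-at {P = Valid (region F)}
      (Columns-Swap exchange-valid flipped-↠ (Columns-word N λ j →
        Valid-flip (letterOf F j) (Describes.is-valid (letterOf-describes j)))) j∈
    ... | no j∉ rewrite at-outside (newWord F) j∉ =
      λ i → ¬-not λ r → j∉ (Box⇒column i (proj₁ (region⁻ F i j r)))

    -- For an offending pair involving a mixed letter `mix p q` and a pure one, convexity extends
    -- the region to rows `p` and `q` of both columns, so a normal word would admit an exchange. For
    -- two mixed letters, `q ≤ i ≤ p′` contradicts separation.
    newLetter-adjacent : ∀ i j → region F i j ≡ true → region F i (suc j) ≡ true →
      hasB (newLetter F j) i ≡ true → hasA (newLetter F (suc j)) i ≡ true → ⊥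
    newLetter-adjacent i j r r′ with Box⇒column i (proj₁ (region⁻ F i j r)) | Box⇒column i (proj₁ (region⁻ F i (suc j) r′))
    newLetter-adjacent i (suc m) r r′ | 1≤j , _ | _ , j<N = go _ _ (newLetter-valid (1 + m)) (newLetter-valid (2 + m))
      (normal-at N (newWord F) (Sort.norm-normal F (Vec.map flip (encode F))) j<N)
      (AllPairs-at newWord-separated 1≤j ≤-refl j<N)
      where
      go : ∀ y x → Valid (region F) (1 + m) y → Valid (region F) (2 + m) x → ¬ Exchange (region F) m y x →
        Separated x y → hasB y i ≡ true → hasA x i ≡ true → ⊥
      go two one _ _ ¬e _ _ _ = ¬e (two-one {i = i} r r′)
      go two (mix p q) _ ((p≤q , _) , rp , rq) ¬e _ _ ha = ¬e (two-mix
        (region-convex p (1 + m) r rp i≤p ≤-refl ≤-refl (n≤1+n _) ,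
         region-convex q (1 + m) r rq (≤-trans i≤p p≤q) ≤-refl ≤-refl (n≤1+n _)) (rp , rq))
        where i≤p = ≤ᵇ-true {i} ha
      go (mix p q) one ((p≤q , _) , rp , rq) _ ¬e _ hb _ = ¬e (mix-one (rp , rq)
        (region-convex p (2 + m) rp r′ ≤-refl (≤-trans p≤q q≤i) (n≤1+n _) ≤-refl ,
         region-convex q (2 + m) rq r′ ≤-refl q≤i (n≤1+n _) ≤-refl))
        where q≤i = ≤ᵇ-true {q} hb
      go (mix p q) (mix p′ q′) _ _ _ p′<q hb ha =
        <-irrefl refl (<-≤-trans p′<q (≤-trans (≤ᵇ-true {q} hb) (≤ᵇ-true {i} ha)))

    -- The box next to the right end lies in the region. If it receives `a`, the distance shrinks;
    -- if it receives `b`, it forms an adjacent offending pair with the right end.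
    newLetter-row : ∀ i j d → region F i j ≡ true → region F i (suc d + j) ≡ true →
      hasB (newLetter F j) i ≡ true → hasA (newLetter F (suc d + j)) i ≡ true → ⊥
    newLetter-row i j zero    r r′ hb ha = newLetter-adjacent i j r r′ hb ha
    newLetter-row i j (suc d) r r′ hb ha
      with region-convex i (suc d + j) r r′ ≤-refl ≤-refl (m≤n+m j (suc d)) (n≤1+n _)
    ... | r″ with ∨-true {hasA (newLetter F (suc d + j)) i} (hasA∨hasB _ (newLetter-valid (suc d + j)) r″)
    ...   | inj₁ ha″ = newLetter-row i j d r r″ hb ha″
    ...   | inj₂ hb″ = newLetter-adjacent i (suc d + j) r″ r′ hb″ ha

    -- The new filling is an SVRPP

    G : Filling
    G = act F

    -- Outside the region both bits are false and the set contains neither `a` nor `b`, so one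
    -- description serves all boxes.
    ∈-act⁻ : ∀ {c} i j → Box i j → c ∈ G i j →
      ∈Replace (region F i j ∧ hasA (newLetter F j) i) (region F i j ∧ hasB (newLetter F j) i) (F i j) c
    ∈-act⁻ i j box c∈ with region F i j in r
    ... | true  = ∈-replace⁻ c∈
    ... | false = other (λ { refl → absurd (inj₁ c∈) }) (λ { refl → absurd (inj₂ c∈) }) c∈
      where
      absurd : a ∈ F i j ⊎ b ∈ F i j → ⊥
      absurd c∈ with () ← trans (sym r) (region⁺ F i j box c∈)

    ∈-act⁺ : ∀ {c} i j →
      ∈Replace (region F i j ∧ hasA (newLetter F j) i) (region F i j ∧ hasB (newLetter F j) i) (F i j) c → c ∈ G i j
    ∈-act⁺ i j c∈ with region F i j
    ∈-act⁺ i j c∈             | true  = ∈-replace⁺ c∈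
    ∈-act⁺ i j (other _ _ c∈) | false = c∈

    region⇒Box : ∀ {c} i j → region F i j ∧ c ≡ true → Box i j
    region⇒Box i j eq = proj₁ (region⁻ F i j (∧-trueˡ eq))

    act-a : ∀ i j → has a G i j ≡ region F i j ∧ hasA (newLetter F j) i
    act-a i j = bool-ext to λ eq → Has⁺ a G i j (region⇒Box i j eq) (∈-act⁺ i j (isA refl eq))
      where
      to : has a G i j ≡ true → region F i j ∧ hasA (newLetter F j) i ≡ true
      to h with Has⁻ a G i j h
      ... | box , a∈ with ∈-act⁻ i j box a∈
      ...   | isA _ eq      = eq
      ...   | isB a≡b _     = contradiction a≡b (<⇒≢ ≤-refl)
      ...   | other a≢a _ _ = contradiction refl a≢a

    act-b : ∀ i j → has b G i j ≡ region F i j ∧ hasB (newLetter F j) i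
    act-b i j = bool-ext to λ eq → Has⁺ b G i j (region⇒Box i j eq) (∈-act⁺ i j (isB refl eq))
      where
      to : has b G i j ≡ true → region F i j ∧ hasB (newLetter F j) i ≡ true
      to h with Has⁻ b G i j h
      ... | box , b∈ with ∈-act⁻ i j box b∈
      ...   | isB _ eq      = eq
      ...   | isA b≡a _     = contradiction (sym b≡a) (<⇒≢ ≤-refl)
      ...   | other _ b≢b _ = contradiction refl b≢b

    act-other : ∀ {c} → c ≢ a → c ≢ b → ∀ i j → has c G i j ≡ has c F i j
    act-other {c} c≢a c≢b i j = bool-ext to from
      where
      to : has c G i j ≡ true → has c F i j ≡ true
      to h with Has⁻ c G i j h
      ... | box , c∈ with ∈-act⁻ i j box c∈
      ...   | isA c≡a _     = contradiction c≡a c≢a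
      ...   | isB c≡b _     = contradiction c≡b c≢b
      ...   | other _ _ c∈F = Has⁺ c F i j box c∈F
      from : has c F i j ≡ true → has c G i j ≡ true
      from h with Has⁻ c F i j h
      ... | box , c∈ = Has⁺ c G i j box (∈-act⁺ i j (other c≢a c≢b c∈))

    -- A valid letter leaves no region row without `a` and `b`. Hence `F` and `G` admit the same
    -- exchanges.
    region-act : ∀ i j → region G i j ≡ region F i j
    region-act i j = trans (cong₂ _∨_ (act-a i j) (act-b i j))
      (trans (sym (∧-distribˡ-∨ (region F i j) _ _)) (bool-ext ∧-trueˡ λ r → cong₂ _∧_ r (hasA∨hasB _ (newLetter-valid j) r)))

    act-describes : ∀ j → Desc G j (newLetter F j)
    act-describes j = record
      { has-a    = λ i → trans (act-a i j) (cong (_∧ hasA (newLetter F j) i) (sym (region-act i j)))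
      ; has-b    = λ i → trans (act-b i j) (cong (_∧ hasB (newLetter F j) i) (sym (region-act i j)))
      ; is-valid = Valid-cong (λ i → sym (region-act i j)) _ (newLetter-valid j) }

    act-valid : ∀ i j → Box i j → ValidSet (G i j)
    act-valid i j box with region F i j in r
    ... | true  = replace-Valid {hasA (newLetter F j) i} (s≤s z≤n) (hasA∨hasB _ (newLetter-valid j) r) (valid i j box)
    ... | false = valid i j box

    -- A set that is changed already contained `a` or `b`, so in `F` it forces every other entry of
    -- the opposite box to the correct side of both values. Only `b` before `a` can go wrong.
    act-≤ : ∀ i j i′ j′ → Box i j → Box i′ j′ → F i j ≤S F i′ j′ →
      (has b G i j ≡ true → has a G i′ j′ ≡ true → ⊥) → G i j ≤S G i′ j′
    act-≤ i j i′ j′ box box′ F≤ no-ba′ = ≤⇒≤S (proj₂ (ValidSet⇒∈ (act-valid i j box))) (proj₂ (ValidSet⇒∈ (act-valid i′ j′ box′)))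
      λ x∈ y∈ → compare-∈ (∈-act⁻ i j box x∈) (∈-act⁻ i′ j′ box′ y∈)
      where
      above : ∀ {c y} → region F i j ∧ c ≡ true → y ≢ a → y ≢ b → y ∈ F i′ j′ → b ≤ y
      above eq y≢a y≢b y∈ with region⁻ F i j (∧-trueˡ eq)
      ... | _ , inj₁ a∈ = ≤∧≢⇒< (≤S⇒≤ F≤ a∈ y∈) (≢-sym y≢a)
      ... | _ , inj₂ b∈ = ≤S⇒≤ F≤ b∈ y∈
      below : ∀ {c x} → region F i′ j′ ∧ c ≡ true → x ≢ a → x ≢ b → x ∈ F i j → x ≤ a
      below eq x≢a x≢b x∈ with region⁻ F i′ j′ (∧-trueˡ eq)
      ... | _ , inj₁ a∈ = ≤S⇒≤ F≤ x∈ a∈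
      ... | _ , inj₂ b∈ = ≤-pred (≤∧≢⇒< (≤S⇒≤ F≤ x∈ b∈) x≢b)
      compare-∈ : ∀ {x y} →
        ∈Replace (region F i j ∧ hasA (newLetter F j) i) (region F i j ∧ hasB (newLetter F j) i) (F i j) x →
        ∈Replace (region F i′ j′ ∧ hasA (newLetter F j′) i′) (region F i′ j′ ∧ hasB (newLetter F j′) i′) (F i′ j′) y →
        x ≤ y
      compare-∈ (isA refl _)      (isA refl _)        = ≤-refl
      compare-∈ (isA refl _)      (isB refl _)        = n≤1+n a
      compare-∈ (isB refl _)      (isB refl _)        = ≤-refl
      compare-∈ (isB refl s)      (isA refl t)        = ⊥-elim (no-ba′ (trans (act-b i j) s) (trans (act-a i′ j′) t))
      compare-∈ (isA refl s)      (other y≢a y≢b y∈) = <⇒≤ (above s y≢a y≢b y∈)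
      compare-∈ (isB refl s)      (other y≢a y≢b y∈) = above s y≢a y≢b y∈
      compare-∈ (other x≢a x≢b x∈) (isA refl t)      = below t x≢a x≢b x∈
      compare-∈ (other x≢a x≢b x∈) (isB refl t)      = m≤n⇒m≤1+n (below t x≢a x≢b x∈)
      compare-∈ (other _ _ x∈)    (other _ _ y∈)      = ≤S⇒≤ F≤ x∈ y∈

    act-SVRPP : IsSVRPP la mu G
    act-SVRPP = record
      { valid = act-valid
      ; rows  = λ i j j′ j<j′ box box′ → act-≤ i j i j′ box box′ (rows i j j′ j<j′ box box′) (row-no-ba i j<j′)
      ; cols  = λ i i′ j i<i′ box box′ → act-≤ i j i′ j box box′ (cols i i′ j i<i′ box box′) (col-no-ba j i<i′) }
      where
      row-no-ba : ∀ i {j j′} → j < j′ → has b G i j ≡ true → has a G i j′ ≡ true → ⊥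
      row-no-ba i {j} {j′} j<j′ hb ha
        -- Rewrites `j′` as `suc d + j`, the form in which `newLetter-row` measures distance.
        with j′ ∸ suc j | trans (sym (m∸n+n≡m j<j′)) (+-suc (j′ ∸ suc j) j) | trans (sym (act-b i j)) hb | trans (sym (act-a i j′)) ha
      ... | d | refl | rb | ra = newLetter-row i j d (∧-trueˡ rb) (∧-trueˡ ra)
        (∧-trueʳ {region F i j} rb) (∧-trueʳ {region F i (suc d + j)} ra)
      col-no-ba : ∀ j {i i′} → i < i′ → has b G i j ≡ true → has a G i′ j ≡ true → ⊥
      col-no-ba j {i} {i′} i<i′ hb ha = <⇒≱ i<i′ (hasB-hasA⇒≤ (newLetter F j) (newLetter-valid j)
        (∧-trueʳ {region F i j} (trans (sym (act-b i j)) hb))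
        (∧-trueʳ {region F i′ j} (trans (sym (act-a i′ j)) ha)))

    -- Effect on the statistics

    link⁺ : ∀ i j → Box i j → Box (suc i) j → Meet (F i j) (F (suc i) j) → link F i j ≡ true
    link⁺ i j box box′ meet = cong₂ _∧_ (Box⇒inB i j box) (cong₂ _∧_ (Box⇒inB (suc i) j box′)
      (Meet⇒max≡min (cols i (suc i) j ≤-refl box box′) meet))

    link⁻ : ∀ i j → link F i j ≡ true → Box i j × Box (suc i) j × Meet (F i j) (F (suc i) j)
    link⁻ i j eq = box , box′ , max≡min⇒Meet (proj₂ (inhabited i j box)) (proj₂ (inhabited (suc i) j box′))
      (∧-trueʳ {inB la mu (suc i) j} rest)
      where
      rest = ∧-trueʳ {inB la mu i j} eq
      box  = inB⇒Box i j (∧-trueˡ eq)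
      box′ = inB⇒Box (suc i) j (∧-trueˡ rest)

    link-region : ∀ {l} i j → Desc F j l → region F i j ≡ true → region F (suc i) j ≡ true →
      toℕ (link F i j) + toℕ (isMix i (suc i) l) ≡ 1
    link-region {l} i j d r r′ with isMix i (suc i) l in mixed
    ... | false = cong (λ c → toℕ c + 0) (linked (unmixed l (Describes.is-valid d) r mixed))
      where
      linked : (hasA l i ≡ true × hasA l (suc i) ≡ true) ⊎ (hasB l i ≡ true × hasB l (suc i) ≡ true) → link F i j ≡ true
      linked (inj₁ (ha , ha′)) =
        let box  , a∈  = Has⁻ a F i j (describes-a (λ _ → refl) d r ha)
            box′ , a∈′ = Has⁻ a F (suc i) j (describes-a (λ _ → refl) d r′ ha′)
        in link⁺ i j box box′ (a , a∈ , a∈′)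
      linked (inj₂ (hb , hb′)) =
        let box  , b∈  = Has⁻ b F i j (describes-b (λ _ → refl) d r hb)
            box′ , b∈′ = Has⁻ b F (suc i) j (describes-b (λ _ → refl) d r′ hb′)
        in link⁺ i j box box′ (b , b∈ , b∈′)
    ... | true = cong (λ c → toℕ c + 1) (unlinked l d mixed)
      where
      unlinked : ∀ l → Desc F j l → isMix i (suc i) l ≡ true → link F i j ≡ false
      unlinked (mix p q) d eq
        with refl ← ≡ᵇ-true {p} {i} (∧-trueˡ eq) | refl ← ≡ᵇ-true {q} (∧-trueʳ {p ≡ᵇ i} eq) = ¬-not separated
        where
        a∈ = Has⁻ a F i j (describes-a (λ _ → refl) d r (true-≤ᵇ (≤-refl {i})))
        b∈ = Has⁻ b F (suc i) j (describes-b (λ _ → refl) d r′ (true-≤ᵇ (≤-refl {suc i})))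
        separated : link F i j ≢ true
        separated linked with link⁻ i j linked
        -- With `a` in the upper and `b` in the lower box, a common entry `c` is `a` or `b`. But `a`
        -- does not occur below row `p = i`, nor `b` above row `q = suc i`.
        ... | box , box′ , c , c∈ , c∈′
          with m≤n⇒m<n∨m≡n (≤S⇒≤ (cols i (suc i) j ≤-refl box box′) (proj₂ a∈) c∈′)
        ...   | inj₂ refl = <-irrefl refl (≤ᵇ-true {suc i} (describes-a⁻ (λ _ → refl) d (Has⁺ a F (suc i) j box′ c∈′)))
        ...   | inj₁ a<c with refl ← ≤-antisym (≤S⇒≤ (cols i (suc i) j ≤-refl box box′) c∈ (proj₂ b∈)) a<c =
          <-irrefl refl (≤ᵇ-true {suc i} (describes-b⁻ (λ _ → refl) d (Has⁺ b F i j box c∈)))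

    newLetter-count : ∀ P → countTo N (P ∘ newLetter F) ≡ countTo N (λ j → P (flip (letterOf F j)))
    newLetter-count P = begin
      countTo N (P ∘ newLetter F)                      ≡⟨ count≡countTo P (newWord F) ⟨
      count P (newWord F)                              ≡⟨ count-Swap P flipped-↠ ⟨
      count P (word N (flip ∘ letterOf F))             ≡⟨ count≡countTo P (word N (flip ∘ letterOf F)) ⟩
      countTo N (P ∘ at (word N (flip ∘ letterOf F))) ≡⟨ countTo-cong N (λ j j∈ → cong P (at-word j∈)) ⟩
      countTo N (λ j → P (flip (letterOf F j)))        ∎
      where open ≡-Reasoning

    newLetter-count-mix : ∀ i i′ → countTo N (isMix i i′ ∘ newLetter F) ≡ countTo N (isMix i i′ ∘ letterOf F)
    newLetter-count-mix i i′ = trans (newLetter-count (isMix i i′)) (countTo-cong N λ j _ → isMix-flip (letterOf F j))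

    ircont-act : ∀ m → ircont la mu G m ≡ ircont la mu F (adjacent k m)
    ircont-act m with m ≟ k | m ≟ suc k
    ... | yes refl | _ = begin
      countTo N (λ j → anyTo R (λ i → has a G i j))     ≡⟨ countTo-cong N (λ j _ → any-a G j (act-describes j)) ⟩
      countTo N (containsA ∘ newLetter F)               ≡⟨ newLetter-count containsA ⟩
      countTo N (λ j → containsA (flip (letterOf F j))) ≡⟨ countTo-cong N (λ j _ → any-b F j (letterOf-describes j)) ⟨
      countTo N (λ j → anyTo R (λ i → has b F i j))     ∎
      where open ≡-Reasoning
    ... | no _ | yes refl = begin
      countTo N (λ j → anyTo R (λ i → has b G i j))            ≡⟨ countTo-cong N (λ j _ → any-b G j (act-describes j)) ⟩
      countTo N (containsB ∘ newLetter F)                      ≡⟨ newLetter-count containsB ⟩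
      countTo N (λ j → containsA (flip (flip (letterOf F j)))) ≡⟨ countTo-cong N (λ j _ → cong containsA (flip-involutive (letterOf F j))) ⟩
      countTo N (λ j → containsA (letterOf F j))               ≡⟨ countTo-cong N (λ j _ → any-a F j (letterOf-describes j)) ⟨
      countTo N (λ j → anyTo R (λ i → has a F i j))            ∎
      where open ≡-Reasoning
    ... | no m≢k | no m≢1+k = countTo-cong N λ j _ → anyTo-cong R λ i →
      act-other (m≢k ∘ suc-injective) (m≢1+k ∘ suc-injective) i j

    -- Having both `a` and `b` costs one extra element, so the indicators stand crosswise: each side
    -- adds that of the other filling.
    excess-act : ∀ i j → excess F i j + toℕ (isMix i i (newLetter F j)) ≡ excess G i j + toℕ (isMix i i (letterOf F j))
    excess-act i j with region F i j in r
    ... | true rewrite Box⇒inB i j (proj₁ (region⁻ F i j r)) = begin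
      length (F i j) ∸ 1 + toℕ (isMix i i l′)
        ≡⟨ cong (λ c → length (F i j) ∸ 1 + toℕ c) (hasA∧hasB l′ (newLetter-valid j)) ⟨
      length (F i j) ∸ 1 + toℕ (hasA l′ i ∧ hasB l′ i)
        ≡⟨ excess-replace {hasA l′ i} (ValidSet⇒Sorted (valid i j box)) (hasA∨hasB l′ (newLetter-valid j) r)
             (trans (cong₂ _∨_ mem-a mem-b) (hasA∨hasB l (Describes.is-valid d) r)) ⟩
      length (replace (hasA l′ i) (hasB l′ i) (F i j)) ∸ 1 + toℕ (memB a (F i j) ∧ memB b (F i j))
        ≡⟨ cong (λ c → length (replace (hasA l′ i) (hasB l′ i) (F i j)) ∸ 1 + toℕ c)
             (trans (cong₂ _∧_ mem-a mem-b) (hasA∧hasB l (Describes.is-valid d))) ⟩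
      length (replace (hasA l′ i) (hasB l′ i) (F i j)) ∸ 1 + toℕ (isMix i i l) ∎
      where
      open ≡-Reasoning
      l   = letterOf F j
      l′  = newLetter F j
      d   = letterOf-describes j
      box = proj₁ (region⁻ F i j r)
      mem-a : memB a (F i j) ≡ hasA l i
      mem-a = trans (cong (_∧ memB a (F i j)) (sym (Box⇒inB i j box))) (trans (Describes.has-a d i) (cong (_∧ hasA l i) r))
      mem-b : memB b (F i j) ≡ hasB l i
      mem-b = trans (cong (_∧ memB b (F i j)) (sym (Box⇒inB i j box))) (trans (Describes.has-b d i) (cong (_∧ hasB l i) r))
    ... | false = cong (λ c → excess F i j + toℕ c)
      (trans (unmixed-outside _ (newLetter-valid j)) (sym (unmixed-outside _ (Describes.is-valid (letterOf-describes j)))))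
      where
      unmixed-outside : ∀ l → Valid (region F) j l → isMix i i l ≡ false
      unmixed-outside l v = ¬-not λ m → contradiction (trans (sym r) (proj₁ (isMix-region l v m))) λ ()

    ex-act : ∀ m → ex la mu G m ≡ ex la mu F m
    ex-act m = begin
      -- Letters are counted over all `N` columns, so the row is padded by columns that contribute
      -- `0`.
      sumTo (part la (suc m)) (excess G (suc m)) ≡⟨ sumTo-≤ (part≤sum la (suc m)) (excess-outside G) ⟩
      sumTo N (excess G (suc m))                 ≡⟨ sumTo-balance N (λ j _ → excess-act (suc m) j) (newLetter-count-mix (suc m) (suc m)) ⟨
      sumTo N (excess F (suc m))                 ≡⟨ sumTo-≤ (part≤sum la (suc m)) (excess-outside F) ⟨
      sumTo (part la (suc m)) (excess F (suc m)) ∎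
      where
      open ≡-Reasoning
      excess-outside : ∀ H j → part la (suc m) < j → excess H (suc m) j ≡ 0
      excess-outside H j la<j rewrite ¬-not {inB la mu (suc m) j} (λ eq → <⇒≱ la<j (proj₂ (inB⇒Box (suc m) j eq))) = refl

  module _ {F : Filling} (svrpp : IsSVRPP la mu F) where

    open Properties svrpp
    module After = Properties act-SVRPP

    -- One of the boxes contains neither `a` nor `b`, before and after, so a shared entry is a
    -- different value, and such values are untouched.
    link-outside : ∀ i j → region F i j ≡ false ⊎ region F (suc i) j ≡ false → link F i j ≡ link G i j
    link-outside i j outside = bool-ext to from
      where
      not-both : region F i j ≡ true → region F (suc i) j ≡ true → ⊥
      not-both = not-both-true outside
      to : link F i j ≡ true → link G i j ≡ true
      to linked with link⁻ i j linked
      ... | box , box′ , c , c∈ , c∈′ =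
        After.link⁺ i j box box′ (c , ∈-act⁺ i j (other c≢a c≢b c∈) , ∈-act⁺ (suc i) j (other c≢a c≢b c∈′))
        where
        c≢a : c ≢ a
        c≢a refl = not-both (region⁺ F i j box (inj₁ c∈)) (region⁺ F (suc i) j box′ (inj₁ c∈′))
        c≢b : c ≢ b
        c≢b refl = not-both (region⁺ F i j box (inj₂ c∈)) (region⁺ F (suc i) j box′ (inj₂ c∈′))
      from : link G i j ≡ true → link F i j ≡ true
      from linked with After.link⁻ i j linked
      ... | box , box′ , c , c∈ , c∈′ with ∈-act⁻ i j box c∈ | ∈-act⁻ (suc i) j box′ c∈′
      ...   | other _ _ c∈F | other _ _ c∈F′ = link⁺ i j box box′ (c , c∈F , c∈F′)
      ...   | isA _ s       | isA _ t        = ⊥-elim (not-both (∧-trueˡ s) (∧-trueˡ t))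
      ...   | isB _ s       | isB _ t        = ⊥-elim (not-both (∧-trueˡ s) (∧-trueˡ t))
      ...   | isA _ s       | isB _ t        = ⊥-elim (not-both (∧-trueˡ s) (∧-trueˡ t))
      ...   | isB _ s       | isA _ t        = ⊥-elim (not-both (∧-trueˡ s) (∧-trueˡ t))
      ...   | isA c≡a _     | other c≢a _ _  = contradiction c≡a c≢a
      ...   | isB c≡b _     | other _ c≢b _  = contradiction c≡b c≢b
      ...   | other c≢a _ _ | isA c≡a _      = contradiction c≡a c≢a
      ...   | other _ c≢b _ | isB c≡b _      = contradiction c≡b c≢b

    -- Inside the region both sides equal `1` by `link-region`. In contrast to `excess-act`, each
    -- indicator stands beside its own filling, because a mixed letter removes a link where it would
    -- add an excess.
    link-act : ∀ i j →
      toℕ (link F i j) + toℕ (isMix i (suc i) (letterOf F j)) ≡ toℕ (link G i j) + toℕ (isMix i (suc i) (newLetter F j))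
    link-act i j = by-cases (region F i j) (region F (suc i) j) refl refl
      where
      both-unmixed : region F i j ≡ false ⊎ region F (suc i) j ≡ false → ∀ l → Valid (region F) j l → isMix i (suc i) l ≡ false
      both-unmixed (inj₁ r)  l v = ¬-not λ m → contradiction (trans (sym r) (proj₁ (isMix-region l v m))) λ ()
      both-unmixed (inj₂ r′) l v = ¬-not λ m → contradiction (trans (sym r′) (proj₂ (isMix-region l v m))) λ ()
      elsewhere : region F i j ≡ false ⊎ region F (suc i) j ≡ false →
        toℕ (link F i j) + toℕ (isMix i (suc i) (letterOf F j)) ≡ toℕ (link G i j) + toℕ (isMix i (suc i) (newLetter F j))
      elsewhere outside = cong₂ (λ c c′ → toℕ c + toℕ c′) (link-outside i j outside)
        (trans (both-unmixed outside _ (Describes.is-valid (letterOf-describes j))) (sym (both-unmixed outside _ (newLetter-valid j))))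
      by-cases : ∀ s s′ → region F i j ≡ s → region F (suc i) j ≡ s′ →
        toℕ (link F i j) + toℕ (isMix i (suc i) (letterOf F j)) ≡ toℕ (link G i j) + toℕ (isMix i (suc i) (newLetter F j))
      by-cases true  true  r r′ = trans (link-region i j (letterOf-describes j) r r′)
        (sym (After.link-region i j (act-describes j) (trans (region-act i j) r) (trans (region-act (suc i) j) r′)))
      by-cases true  false _ r′ = elsewhere (inj₂ r′)
      by-cases false _     r _  = elsewhere (inj₁ r)

    ceq-act : ∀ m → ceq la mu G m ≡ ceq la mu F m
    ceq-act m = begin
      countTo (part la (suc m)) (link G (suc m))       ≡⟨ countTo≡sumTo (part la (suc m)) ⟩
      sumTo (part la (suc m)) (toℕ ∘ link G (suc m)) ≡⟨ sumTo-≤ (part≤sum la (suc m)) (link-outside-shape G) ⟩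
      sumTo N (toℕ ∘ link G (suc m))
        ≡⟨ sumTo-balance N (λ j _ → link-act (suc m) j) (sym (newLetter-count-mix (suc m) (2 + m))) ⟨
      sumTo N (toℕ ∘ link F (suc m))                   ≡⟨ sumTo-≤ (part≤sum la (suc m)) (link-outside-shape F) ⟨
      sumTo (part la (suc m)) (toℕ ∘ link F (suc m)) ≡⟨ countTo≡sumTo (part la (suc m)) ⟨
      countTo (part la (suc m)) (link F (suc m))       ∎
      where
      open ≡-Reasoning
      link-outside-shape : ∀ H j → part la (suc m) < j → toℕ (link H (suc m) j) ≡ 0
      link-outside-shape H j la<j
        rewrite ¬-not {inB la mu (suc m) j} (λ eq → <⇒≱ la<j (proj₂ (inB⇒Box (suc m) j eq))) = refl

    letterOf-act : ∀ j → letterOf G j ≡ newLetter F j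
    letterOf-act j = describes-unique (λ _ → refl) (After.letterOf-describes j) (act-describes j)

    -- The reversed sorting steps lead from the flipped `newWord F` to `encode F`. That word is
    -- normal because `F` is an SVRPP, also for `G`, whose region is the same; so it is the normal
    -- form.
    newWord-act : newWord G ≡ encode F
    newWord-act = trans (cong (Sort.norm G ∘ Vec.map flip) (word-unique (newWord F) λ j _ → letterOf-act j))
      (Sort.norm-unique G
        (Star.map (Swap-map (exchange-cong λ i j → sym (region-act i j))) unflipped)
        (Normal-cong F G (λ i j → sym (region-act i j)) encode-normal))
      where
      unflipped : Sort._↠_ F (Vec.map flip (newWord F)) (encode F)
      unflipped = subst (Sort._↠_ F (Vec.map flip (newWord F))) (map-flip-involutive (encode F))
        (Star.reverse id (Star.gmap (Vec.map flip) flip-Swap (Sort.norm-↠ F (Vec.map flip (encode F)))))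

    act-involutive : SameOn la mu (act (act F)) F
    act-involutive i j box = Sorted-ext (ValidSet⇒Sorted (After.act-valid i j box)) (ValidSet⇒Sorted (IsSVRPP.valid svrpp i j box)) to from
      where
      letter : newLetter G j ≡ letterOf F j
      letter = trans (cong (λ w → at w j) newWord-act) (at-word (Box⇒column i box))
      a-kept : region G i j ∧ hasA (newLetter G j) i ≡ has a F i j
      a-kept = trans (cong₂ (λ s l → s ∧ hasA l i) (region-act i j) letter) (sym (Describes.has-a (letterOf-describes j) i))
      b-kept : region G i j ∧ hasB (newLetter G j) i ≡ has b F i j
      b-kept = trans (cong₂ (λ s l → s ∧ hasB l i) (region-act i j) letter) (sym (Describes.has-b (letterOf-describes j) i))
      to : ∀ {c} → c ∈ act G i j → c ∈ F i j
      to c∈ with After.∈-act⁻ i j box c∈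
      ... | isA refl s = proj₂ (Has⁻ a F i j (trans (sym a-kept) s))
      ... | isB refl s = proj₂ (Has⁻ b F i j (trans (sym b-kept) s))
      ... | other c≢a c≢b c∈G with ∈-act⁻ i j box c∈G
      ...   | other _ _ c∈F = c∈F
      ...   | isA c≡a _     = contradiction c≡a c≢a
      ...   | isB c≡b _     = contradiction c≡b c≢b
      from : ∀ {c} → c ∈ F i j → c ∈ act G i j
      from {c} c∈ with c ≟ a | c ≟ b
      ... | yes refl | _        = After.∈-act⁺ i j (isA refl (trans a-kept (Has⁺ a F i j box c∈)))
      ... | no _     | yes refl = After.∈-act⁺ i j (isB refl (trans b-kept (Has⁺ b F i j box c∈)))
      ... | no c≢a   | no c≢b   = After.∈-act⁺ i j (other c≢a c≢b (∈-act⁺ i j (other c≢a c≢b c∈)))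

-- Products of adjacent transpositions

adjacent-self : ∀ k → adjacent k k ≡ suc k
adjacent-self k with k ≟ k | k ≟ suc k
... | yes _ | _ = refl
... | no ¬p | _ = contradiction refl ¬p

adjacent-below : ∀ {k m} → m < k → adjacent k m ≡ m
adjacent-below {k} {m} m<k with m ≟ k | m ≟ suc k
... | yes refl | _        = contradiction m<k (<-irrefl refl)
... | no _     | yes refl = contradiction m<k (<⇒≯ ≤-refl)
... | no _     | no _     = refl

adjacent-involutive : ∀ k m → adjacent k (adjacent k m) ≡ m
adjacent-involutive k m with m ≟ k | m ≟ suc k
... | yes refl | _ with suc k ≟ k | suc k ≟ suc k
...   | yes ()   | _
...   | no _     | yes _ = refl
...   | no _     | no ¬p = contradiction refl ¬p
adjacent-involutive k m | no _ | yes refl = adjacent-self k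
adjacent-involutive k m | no m≢k | no m≢1+k with m ≟ k | m ≟ suc k
... | yes p | _     = contradiction p m≢k
... | no _  | yes p = contradiction p m≢1+k
... | no _  | no _  = refl

perm perm⁻¹ : List ℕ → ℕ → ℕ
perm []       m = m
perm (k ∷ ks) m = adjacent k (perm ks m)
perm⁻¹ []       m = m
perm⁻¹ (k ∷ ks) m = perm⁻¹ ks (adjacent k m)

perm⁻¹-perm : ∀ ks m → perm⁻¹ ks (perm ks m) ≡ m
perm⁻¹-perm []       m = refl
perm⁻¹-perm (k ∷ ks) m = trans (cong (perm⁻¹ ks) (adjacent-involutive k (perm ks m))) (perm⁻¹-perm ks m)

perm-perm⁻¹ : ∀ ks m → perm ks (perm⁻¹ ks m) ≡ m
perm-perm⁻¹ []       m = refl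
perm-perm⁻¹ (k ∷ ks) m = trans (cong (adjacent k) (perm-perm⁻¹ ks (adjacent k m))) (adjacent-involutive k m)

perm-++ : ∀ ks ls m → perm (ks ++ ls) m ≡ perm ks (perm ls m)
perm-++ []       ls m = refl
perm-++ (k ∷ ks) ls m = cong (adjacent k) (perm-++ ks ls m)

-- A cycle: `n` rises to `d + n`, the numbers from `suc n` to `d + n` drop by one, all others stay.
raise : ℕ → ℕ → List ℕ
raise n zero    = []
raise n (suc d) = d + n ∷ raise n d

perm-raise : ∀ n d → perm (raise n d) n ≡ d + n
perm-raise n zero    = refl
perm-raise n (suc d) = trans (cong (adjacent (d + n)) (perm-raise n d)) (adjacent-self (d + n))

perm-raise-below : ∀ {n m} d → m < n → perm (raise n d) m ≡ m
perm-raise-below zero    m<n = refl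
perm-raise-below {n} (suc d) m<n = trans (cong (adjacent (d + n)) (perm-raise-below d m<n))
  (adjacent-below (<-≤-trans m<n (m≤n+m n d)))

-- Extends the agreement by one value. If the product so far sends `u` to `f n`, injectivity of `f`
-- gives `n ≤ u`; the cycle taking `n` to `u` is applied before that product and fixes everything
-- below `n`.
agreeing : (ℕ → ℕ) → ℕ → List ℕ
agreeing f zero    = []
agreeing f (suc n) = agreeing f n ++ raise n (perm⁻¹ (agreeing f n) (f n) ∸ n)

perm-agreeing : ∀ {f} → (∀ {m n} → f m ≡ f n → m ≡ n) → ∀ n {m} → m < n → perm (agreeing f n) m ≡ f m
perm-agreeing {f} f-injective (suc n) {m} m<1+n =
  trans (perm-++ ks (raise n (u ∸ n)) m) (agree (m≤n⇒m<n∨m≡n (≤-pred m<1+n)))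
  where
  ks = agreeing f n
  u  = perm⁻¹ ks (f n)
  n≤u : n ≤ u
  n≤u = ≮⇒≥ λ u<n → <⇒≢ u<n
    (f-injective (trans (sym (perm-agreeing f-injective n u<n)) (perm-perm⁻¹ ks (f n))))
  agree : m < n ⊎ m ≡ n → perm ks (perm (raise n (u ∸ n)) m) ≡ f m
  agree (inj₁ m<n)  = trans (cong (perm ks) (perm-raise-below (u ∸ n) m<n)) (perm-agreeing f-injective n m<n)
  agree (inj₂ refl) = trans (cong (perm ks) (trans (perm-raise n (u ∸ n)) (m∸n+n≡m n≤u))) (perm-perm⁻¹ ks (f n))

-- Least bounds of finitely supported sequences

Bounded : (ℕ → ℕ) → ℕ → Set
Bounded α n = ∀ m → n ≤ m → α m ≡ 0

leastBound : (ℕ → ℕ) → ℕ → ℕ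
leastBound α zero = zero
leastBound α (suc n) with α n
... | zero  = leastBound α n
... | suc _ = suc n

leastBound-bounded : ∀ {α} n → Bounded α n → Bounded α (leastBound α n)
leastBound-bounded zero bounded = bounded
leastBound-bounded {α} (suc n) bounded with α n in eq
... | suc _ = bounded
... | zero  = leastBound-bounded n λ m n≤m → [ bounded m , (λ { refl → eq }) ]′ (m≤n⇒m<n∨m≡n n≤m)

leastBound-least : ∀ {α m} n → Bounded α m → leastBound α n ≤ m
leastBound-least zero    _ = z≤n
leastBound-least {α} (suc n) bounded with α n in eq
... | zero  = leastBound-least n bounded
... | suc _ = ≰⇒> λ m≤n → 1+n≢0 (trans (sym eq) (bounded n m≤n))

leastBound-unique : ∀ {α m n} → Bounded α m → Bounded α n → leastBound α m ≡ leastBound α n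
leastBound-unique {m = m} {n} bm bn = ≤-antisym
  (leastBound-least m (leastBound-bounded n bn)) (leastBound-least n (leastBound-bounded m bm))

-- From adjacent transpositions to arbitrary permutations

module _ (la mu : List ℕ) (la-part : IsPartition la) (mu-part : IsPartition mu) where

  open Shape la mu la-part mu-part
  module I = Involution la mu la-part mu-part

  -- Each `I.act k` is its own inverse on SVRPPs, so the product in reverse order undoes the
  -- product.
  apply undo : List ℕ → Filling → Filling
  apply []       F = F
  apply (k ∷ ks) F = apply ks (I.act k F)
  undo []       F = F
  undo (k ∷ ks) F = I.act k (undo ks F)

  apply-cong : ∀ ks {F G} → SameOn la mu F G → SameOn la mu (apply ks F) (apply ks G)
  apply-cong []       same = same
  apply-cong (k ∷ ks) same = apply-cong ks (I.act-cong k same)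

  undo-cong : ∀ ks {F G} → SameOn la mu F G → SameOn la mu (undo ks F) (undo ks G)
  undo-cong []       same = same
  undo-cong (k ∷ ks) same = I.act-cong k (undo-cong ks same)

  act-SVRPP : ∀ k {F} → IsSVRPP la mu F → IsSVRPP la mu (I.act k F)
  act-SVRPP k = I.Properties.act-SVRPP k

  apply-SVRPP : ∀ ks {F} → IsSVRPP la mu F → IsSVRPP la mu (apply ks F)
  apply-SVRPP []       s = s
  apply-SVRPP (k ∷ ks) s = apply-SVRPP ks (act-SVRPP k s)

  undo-SVRPP : ∀ ks {F} → IsSVRPP la mu F → IsSVRPP la mu (undo ks F)
  undo-SVRPP []       s = s
  undo-SVRPP (k ∷ ks) s = act-SVRPP k (undo-SVRPP ks s)

  SameOn-trans : ∀ {F G H} → SameOn la mu F G → SameOn la mu G H → SameOn la mu F H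
  SameOn-trans F≗G G≗H i j box = trans (F≗G i j box) (G≗H i j box)

  undo-apply : ∀ ks {F} → IsSVRPP la mu F → SameOn la mu (undo ks (apply ks F)) F
  undo-apply []       s = λ _ _ _ → refl
  undo-apply (k ∷ ks) s = SameOn-trans (I.act-cong k (undo-apply ks (act-SVRPP k s))) (I.act-involutive k s)

  apply-undo : ∀ ks {F} → IsSVRPP la mu F → SameOn la mu (apply ks (undo ks F)) F
  apply-undo []       s = λ _ _ _ → refl
  apply-undo (k ∷ ks) s = SameOn-trans (apply-cong ks (I.act-involutive k (undo-SVRPP ks s))) (apply-undo ks s)

  ircont-apply : ∀ ks {F} → IsSVRPP la mu F → ∀ m → ircont la mu (apply ks F) m ≡ ircont la mu F (perm ks m)
  ircont-apply []       s m = refl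
  ircont-apply (k ∷ ks) s m = trans (ircont-apply ks (act-SVRPP k s) m) (I.Properties.ircont-act k s (perm ks m))

  ircont-undo : ∀ ks {F} → IsSVRPP la mu F → ∀ m → ircont la mu (undo ks F) m ≡ ircont la mu F (perm⁻¹ ks m)
  ircont-undo []       s m = refl
  ircont-undo (k ∷ ks) s m = trans (I.Properties.ircont-act k (undo-SVRPP ks s) m) (ircont-undo ks s (adjacent k m))

  ceq-apply : ∀ ks {F} → IsSVRPP la mu F → ∀ m → ceq la mu (apply ks F) m ≡ ceq la mu F m
  ceq-apply []       s m = refl
  ceq-apply (k ∷ ks) s m = trans (ceq-apply ks (act-SVRPP k s) m) (I.ceq-act k s m)

  ceq-undo : ∀ ks {F} → IsSVRPP la mu F → ∀ m → ceq la mu (undo ks F) m ≡ ceq la mu F m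
  ceq-undo []       s m = refl
  ceq-undo (k ∷ ks) s m = trans (I.ceq-act k (undo-SVRPP ks s) m) (ceq-undo ks s m)

  ex-apply : ∀ ks {F} → IsSVRPP la mu F → ∀ m → ex la mu (apply ks F) m ≡ ex la mu F m
  ex-apply []       s m = refl
  ex-apply (k ∷ ks) s m = trans (ex-apply ks (act-SVRPP k s) m) (I.Properties.ex-act k s m)

  ex-undo : ∀ ks {F} → IsSVRPP la mu F → ∀ m → ex la mu (undo ks F) m ≡ ex la mu F m
  ex-undo []       s m = refl
  ex-undo (k ∷ ks) s m = trans (I.Properties.ex-act k (undo-SVRPP ks s) m) (ex-undo ks s m)

  entryBound : Filling → ℕ
  entryBound F = sumTo N λ j → sumTo R λ i → maxL (F i j)

  ircont-bounded : ∀ F → Bounded (ircont la mu F) (entryBound F)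
  ircont-bounded F m bound≤m = trans (countTo-cong N λ j _ → ¬-not (unused j)) (zero-count N)
    where
    unused : ∀ j → anyTo R (λ i → has (suc m) F i j) ≢ true
    unused j any with anyTo⁻ R any
    ... | i , i∈ , h with Has⁻ (suc m) F i j h
    ...   | box , m∈ = <⇒≱ (∈⇒≤maxL m∈) (≤-trans (≤sumTo R {f = λ i → maxL (F i j)} i∈)
      (≤-trans (≤sumTo N {f = λ j → sumTo R λ i → maxL (F i j)} (Box⇒column i box)) bound≤m))
    zero-count : ∀ n → countTo n (λ _ → false) ≡ 0
    zero-count zero    = refl
    zero-count (suc n) = trans (+-identityʳ _) (zero-count n)

  module Symmetry (σ : ℕ ↔ ℕ) (α γ θ : ℕ → ℕ) where

    private
      module σ = Inverse σ

    β : ℕ → ℕ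
    β = α ∘ σ.to

    to-injective : ∀ {m n} → σ.to m ≡ σ.to n → m ≡ n
    to-injective {m} {n} eq = trans (sym (σ.strictlyInverseʳ m)) (trans (cong σ.from eq) (σ.strictlyInverseʳ n))

    -- `β m` can be nonzero only if `m = σ.from v` for some `v < n`, and the sum of all these values
    -- dominates each. The shift `i ∸ 1` is due to `sumTo` starting at `1`.
    β-bounded : ∀ {n} → Bounded α n → Bounded β (suc (sumTo n (λ i → σ.from (i ∸ 1))))
    β-bounded {n} bounded m bound≤m = bounded (σ.to m) (≮⇒≥ λ σm<n → <⇒≱ bound≤m
      (subst (_≤ sumTo n (λ i → σ.from (i ∸ 1))) (σ.strictlyInverseʳ m)
        (≤sumTo n {f = λ i → σ.from (i ∸ 1)} (s≤s z≤n , σm<n))))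

    -- The least bound of β depends on β alone, so that SVRPPs with different
    -- entries are acted on by the same product of transpositions.
    transpositions : ℕ → List ℕ
    transpositions n = agreeing σ.to (leastBound β n)

    α-perm : ∀ {n} → Bounded β n → ∀ m → α (perm (transpositions n) m) ≡ β m
    α-perm {n} bounded m with m <? leastBound β n
    ... | yes m<M = cong α (perm-agreeing to-injective (leastBound β n) m<M)
    -- Beyond the bound the product need not agree with `σ`. Since both send the numbers below it to
    -- the same values, `v` is not the `σ`-image of such a number, so `α v` is a value of `β` beyond
    -- its bound, like `β m`.
    ... | no m≮M = trans (trans (cong α (sym (σ.strictlyInverseˡ v))) (bounded′ (σ.from v) (≮⇒≥ outside)))
                     (sym (bounded′ m (≮⇒≥ m≮M)))
      where
      ks = transpositions n
      v  = perm ks m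
      bounded′ = leastBound-bounded n bounded
      outside : ¬ (σ.from v < leastBound β n)
      outside lt = m≮M (subst (_< leastBound β n) same lt)
        where
        same : σ.from v ≡ m
        same = trans (sym (perm⁻¹-perm ks (σ.from v))) (trans
          (cong (perm⁻¹ ks) (trans (perm-agreeing to-injective (leastBound β n) lt) (σ.strictlyInverseˡ v)))
          (perm⁻¹-perm ks m))

    boundA : Coeff la mu α γ θ → ℕ
    boundA (F , _) = suc (sumTo (entryBound F) (λ i → σ.from (i ∸ 1)))

    boundA-bounded : ∀ A → Bounded β (boundA A)
    boundA-bounded (F , _ , irc , _) = β-bounded λ m le → trans (sym (irc m)) (ircont-bounded F m le)

    boundB : Coeff la mu β γ θ → ℕ
    boundB (F , _) = entryBound F

    boundB-bounded : ∀ B → Bounded β (boundB B)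
    boundB-bounded (F , _ , irc , _) m le = trans (sym (irc m)) (ircont-bounded F m le)

    same-transpositions : ∀ {m n} → Bounded β m → Bounded β n → transpositions m ≡ transpositions n
    same-transpositions bm bn = cong (agreeing σ.to) (leastBound-unique bm bn)

    forward : Coeff la mu α γ θ → Coeff la mu β γ θ
    forward A@(F , s , irc , ce , e) = apply ks F , apply-SVRPP ks s ,
      (λ m → trans (ircont-apply ks s m) (trans (irc (perm ks m)) (α-perm (boundA-bounded A) m))) ,
      (λ m → trans (ceq-apply ks s m) (ce m)) ,
      (λ m → trans (ex-apply ks s m) (e m))
      where ks = transpositions (boundA A)

    backward : Coeff la mu β γ θ → Coeff la mu α γ θ
    backward B@(F , s , irc , ce , e) = undo ks F , undo-SVRPP ks s ,
      (λ m → trans (ircont-undo ks s m) (trans (irc (perm⁻¹ ks m))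
        (trans (sym (α-perm (boundB-bounded B) (perm⁻¹ ks m))) (cong α (perm-perm⁻¹ ks m))))) ,
      (λ m → trans (ceq-undo ks s m) (ce m)) ,
      (λ m → trans (ex-undo ks s m) (e m))
      where ks = transpositions (boundB B)

    symmetric : CoeffEq la mu α γ θ β γ θ
    symmetric = record
      { to        = forward
      ; from      = backward
      ; to-cong   = λ A A′ same → subst (λ ks → SameOn la mu (apply (transpositions (boundA A)) (proj₁ A)) (apply ks (proj₁ A′)))
          (same-transpositions (boundA-bounded A) (boundA-bounded A′))
          (apply-cong (transpositions (boundA A)) same)
      ; from-cong = λ B B′ same → subst (λ ks → SameOn la mu (undo (transpositions (boundB B)) (proj₁ B)) (undo ks (proj₁ B′)))
          (same-transpositions (boundB-bounded B) (boundB-bounded B′))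
          (undo-cong (transpositions (boundB B)) same)
      ; from-to   = λ A → subst (λ ks → SameOn la mu (undo ks (proj₁ (forward A))) (proj₁ A))
          (same-transpositions (boundA-bounded A) (boundB-bounded (forward A)))
          (undo-apply (transpositions (boundA A)) (proj₁ (proj₂ A)))
      ; to-from   = λ B → subst (λ ks → SameOn la mu (apply ks (proj₁ (backward B))) (proj₁ B))
          (same-transpositions (boundB-bounded B) (boundA-bounded (backward B)))
          (apply-undo (transpositions (boundB B)) (proj₁ (proj₂ B)))
      }

theorem1p2 : (la mu : List ℕ) → IsPartition la → IsPartition mu → mu ⊆ₚ la
    → (σ : ℕ ↔ ℕ) (α γ θ : ℕ → ℕ)
    → CoeffEq la mu α γ θ (α ∘ Inverse.to σ) γ θ
theorem1p2 la mu la-part mu-part _ = Symmetry.symmetric la mu la-part mu-part
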